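{- There exists a universal constant $C > 0$ such that for all positive integers $m$ and $n$, and all matrices $A \in \mathbb{R}^{m\times n}$, $$\mathrm{herdisc}(A) \le C\sqrt{n}\cdot \mathrm{detlb}(A).$$
   Context: For a real $m\times n$ matrix $A$, the discrepancy is $\mathrm{disc}(A) = \min_{x\in\{\pm1\}^n}\|Ax\|_\infty$. The hereditary discrepancy $\mathrm{herdisc}(A)$ is the maximum of $\mathrm{disc}(B)$ over all submatrices $B$ of $A$ (equivalently, over all submatrices consisting of a nonempty subset of the columns of $A$). The determinant lower bound is $\mathrm{detlb}(A) = \max_{k}\max_{B}|\det(B)|^{1/k}$, where $k$ ranges over $1\le k\le \min(m,n)$ and $B$ over all $k\times k$ submatrices of $A$ (any $k$ rows and any $k$ columns). -}

module Defs where

open import Algebra.Bundles.Raw using (RawRing)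
open import Data.Bool.Base using (Bool; true; false; if_then_else_; T)
open import Data.Fin.Base as Fin using (Fin; toℕ; punchIn)
open import Data.Integer.Base as ℤ using (ℤ; +_)
import Data.Integer.Properties as ℤₚ
open import Data.Integer.Solver using () renaming (module +-*-Solver to ℤ-Solver)
open import Data.List.Base as List using (List; []; [_]; _++_; upTo)
open import Data.List.NonEmpty as List⁺ using (List⁺; _⁺++⁺_)
open import Data.Nat.Base as ℕ using (ℕ; zero; suc; z≤n; s≤s)
import Data.Nat.Properties as ℕₚ
open import Data.Product.Base using (∃; ∃-syntax; _×_; _,_; proj₁; proj₂)
open import Data.Rational.Base as ℚ using (ℚ; mkℚ; 0ℚ; 1ℚ; ½; ↥_)
import Data.Rational.Properties as ℚₚ
open import Data.Rational.Solver using (module +-*-Solver)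
import Data.Rational.Unnormalised.Base as ℚᵘ
import Data.Rational.Unnormalised.Properties as ℚᵘₚ
open import Data.Sign.Base as Sign using (Sign)
open import Data.Sum.Base using (inj₁; inj₂)
open import Data.Unit.Base using (tt)
open import Data.Vec.Functional as Vector using (Vector; _∷_)
open import Function.Base using (_∘_; _$_)
open import Level using (0ℓ)
open import Relation.Binary.PropositionalEquality
  using (_≡_; refl; sym; trans; cong; cong₂; subst; subst₂)
open import Relation.Nullary.Negation using (¬_; contradiction)

private

  0<½ : 0ℚ ℚ.< ½
  0<½ = ℚₚ.positive⁻¹ ½

  module _ where
    open +-*-Solver

    ½+½ : ∀ ε → ½ ℚ.* ε ℚ.+ ½ ℚ.* ε ≡ ε
    ½+½ = solve 1 (λ e → con ½ :* e :+ con ½ :* e := e) refl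

    telescope : ∀ p q r → (p ℚ.- q) ℚ.+ (q ℚ.- r) ≡ p ℚ.- r
    telescope = solve 3 (λ p q r → (p :- q) :+ (q :- r) := p :- r) refl

    shift : ∀ p q → q ℚ.+ (p ℚ.- q) ≡ p
    shift = solve 2 (λ p q → q :+ (p :- q) := p) refl

    flip-neg : ∀ p q → ℚ.- (p ℚ.- q) ≡ q ℚ.- p
    flip-neg = solve 2 (λ p q → :- (p :- q) := q :- p) refl

    neg-diff : ∀ p q → ℚ.- (p ℚ.- q) ≡ ℚ.- p ℚ.- ℚ.- q
    neg-diff = solve 2 (λ p q → :- (p :- q) := :- p :- :- q) refl

    sum-diff : ∀ p q r s → (p ℚ.- r) ℚ.+ (q ℚ.- s) ≡ (p ℚ.+ q) ℚ.- (r ℚ.+ s)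
    sum-diff = solve 4 (λ p q r s → (p :- r) :+ (q :- s) := (p :+ q) :- (r :+ s)) refl

    prod-diff : ∀ p q r s → p ℚ.* (q ℚ.- s) ℚ.+ (p ℚ.- r) ℚ.* s ≡ p ℚ.* q ℚ.- r ℚ.* s
    prod-diff = solve 4 (λ p q r s → p :* (q :- s) :+ (p :- r) :* s := p :* q :- r :* s) refl

  0<½* : ∀ {ε} → 0ℚ ℚ.< ε → 0ℚ ℚ.< ½ ℚ.* ε
  0<½* {ε} 0<ε = ℚₚ.positive⁻¹ _ {{ℚₚ.pos*pos⇒pos ½ ε {{ℚ.positive 0<ε}}}}

  p≤∣p∣ : ∀ p → p ℚ.≤ ℚ.∣ p ∣
  p≤∣p∣ p with ℚₚ.≤-total 0ℚ p
  ... | inj₁ 0≤p = ℚₚ.≤-reflexive (sym (ℚₚ.0≤p⇒∣p∣≡p 0≤p))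
  ... | inj₂ p≤0 = ℚₚ.≤-trans p≤0 (ℚₚ.0≤∣p∣ p)

  ∣-∣-least : ∀ {p q} → p ℚ.≤ q → ℚ.- p ℚ.≤ q → ℚ.∣ p ∣ ℚ.≤ q
  ∣-∣-least {p} p≤q -p≤q with ℚₚ.∣p∣≡p∨∣p∣≡-p p
  ... | inj₁ eq = subst (ℚ._≤ _) (sym eq) p≤q
  ... | inj₂ eq = subst (ℚ._≤ _) (sym eq) -p≤q

  ∣p-q∣≡∣q-p∣ : ∀ p q → ℚ.∣ p ℚ.- q ∣ ≡ ℚ.∣ q ℚ.- p ∣
  ∣p-q∣≡∣q-p∣ p q = trans (sym (ℚₚ.∣-p∣≡∣p∣ (p ℚ.- q))) (cong ℚ.∣_∣ (flip-neg p q))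

  p≤q+∣p-q∣ : ∀ p q → p ℚ.≤ q ℚ.+ ℚ.∣ p ℚ.- q ∣
  p≤q+∣p-q∣ p q = subst (ℚ._≤ q ℚ.+ ℚ.∣ p ℚ.- q ∣) (shift p q) (ℚₚ.+-monoʳ-≤ q (p≤∣p∣ (p ℚ.- q)))

  ∣-∣-close : ∀ {p q δ} → p ℚ.≤ q ℚ.+ δ → q ℚ.≤ p ℚ.+ δ → ℚ.∣ p ℚ.- q ∣ ℚ.≤ δ
  ∣-∣-close {p} {q} {δ} p≤ q≤ = ∣-∣-least (move p≤) (subst (ℚ._≤ δ) (sym (flip-neg p q)) (move q≤))
    where
    open +-*-Solver
    move : ∀ {a b} → a ℚ.≤ b ℚ.+ δ → a ℚ.- b ℚ.≤ δ
    move {a} {b} a≤ = subst (a ℚ.- b ℚ.≤_)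
      (solve 2 (λ b d → (b :+ d) :- b := d) refl b δ) (ℚₚ.+-monoˡ-≤ (ℚ.- b) a≤)

  NonExpanding : (ℚ → ℚ → ℚ) → Set
  NonExpanding _∙_ = ∀ p q r s → ℚ.∣ (p ∙ q) ℚ.- (r ∙ s) ∣ ℚ.≤ ℚ.∣ p ℚ.- r ∣ ℚ.+ ℚ.∣ q ℚ.- s ∣

  +-nonExpanding : NonExpanding ℚ._+_
  +-nonExpanding p q r s = subst (ℚ._≤ ℚ.∣ p ℚ.- r ∣ ℚ.+ ℚ.∣ q ℚ.- s ∣)
    (cong ℚ.∣_∣ (sum-diff p q r s)) (ℚₚ.∣p+q∣≤∣p∣+∣q∣ (p ℚ.- r) (q ℚ.- s))

  module _ (_∙_ : ℚ → ℚ → ℚ)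
           (mono : ∀ {p q r s} → p ℚ.≤ r → q ℚ.≤ s → (p ∙ q) ℚ.≤ (r ∙ s))
           (trl : ∀ p q δ → ((p ℚ.+ δ) ∙ (q ℚ.+ δ)) ≡ (p ∙ q) ℚ.+ δ) where

    lattice-nonExpanding : NonExpanding _∙_
    lattice-nonExpanding p q r s = ∣-∣-close
      (subst ((p ∙ q) ℚ.≤_) (trl r s δ) (mono
        (ℚₚ.≤-trans (p≤q+∣p-q∣ p r) (ℚₚ.+-monoʳ-≤ r δ₁≤δ))
        (ℚₚ.≤-trans (p≤q+∣p-q∣ q s) (ℚₚ.+-monoʳ-≤ s δ₂≤δ))))
      (subst ((r ∙ s) ℚ.≤_) (trl p q δ) (mono
        (ℚₚ.≤-trans (p≤q+∣p-q∣ r p) (ℚₚ.+-monoʳ-≤ p (subst (ℚ._≤ δ) (∣p-q∣≡∣q-p∣ p r) δ₁≤δ)))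
        (ℚₚ.≤-trans (p≤q+∣p-q∣ s q) (ℚₚ.+-monoʳ-≤ q (subst (ℚ._≤ δ) (∣p-q∣≡∣q-p∣ q s) δ₂≤δ)))))
      where
      δ₁ δ₂ δ : ℚ
      δ₁ = ℚ.∣ p ℚ.- r ∣
      δ₂ = ℚ.∣ q ℚ.- s ∣
      δ = δ₁ ℚ.+ δ₂
      δ₁≤δ : δ₁ ℚ.≤ δ
      δ₁≤δ = subst (ℚ._≤ δ) (ℚₚ.+-identityʳ δ₁) (ℚₚ.+-monoʳ-≤ δ₁ (ℚₚ.0≤∣p∣ (q ℚ.- s)))
      δ₂≤δ : δ₂ ℚ.≤ δ
      δ₂≤δ = subst (ℚ._≤ δ) (ℚₚ.+-identityˡ δ₂) (ℚₚ.+-monoˡ-≤ δ₂ (ℚₚ.0≤∣p∣ (p ℚ.- r)))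

  ⊔-nonExpanding : NonExpanding ℚ._⊔_
  ⊔-nonExpanding = lattice-nonExpanding ℚ._⊔_ ℚₚ.⊔-mono-≤
    (λ p q δ → sym (ℚₚ.mono-≤-distrib-⊔ (ℚₚ.+-monoˡ-≤ δ) p q))

  ⊓-nonExpanding : NonExpanding ℚ._⊓_
  ⊓-nonExpanding = lattice-nonExpanding ℚ._⊓_ ℚₚ.⊓-mono-≤
    (λ p q δ → sym (ℚₚ.mono-≤-distrib-⊓ (ℚₚ.+-monoˡ-≤ δ) p q))

IsCauchy : (ℕ → ℚ) → Set
IsCauchy s = ∀ ε → 0ℚ ℚ.< ε →
  ∃[ N ] ∀ m n → N ℕ.≤ m → N ℕ.≤ n → ℚ.∣ s m ℚ.- s n ∣ ℚ.< ε

-- Reals are Cauchy sequences of rationals, compared up to _≃_ rather than _≡_.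
record ℝ : Set where
  constructor mkℝ
  field
    seq    : ℕ → ℚ
    cauchy : IsCauchy seq

open ℝ public

infix 4 _≃_ _≤_ _<_

_≃_ : ℝ → ℝ → Set
x ≃ y = ∀ ε → 0ℚ ℚ.< ε → ∃[ N ] ∀ n → N ℕ.≤ n → ℚ.∣ seq x n ℚ.- seq y n ∣ ℚ.< ε

_≤_ : ℝ → ℝ → Set
x ≤ y = ∀ ε → 0ℚ ℚ.< ε → ∃[ N ] ∀ n → N ℕ.≤ n → seq x n ℚ.≤ seq y n ℚ.+ ε

_<_ : ℝ → ℝ → Set
x < y = ∃[ ε ] 0ℚ ℚ.< ε × ∃[ N ] ∀ n → N ℕ.≤ n → seq x n ℚ.+ ε ℚ.≤ seq y n

private

  ≤-⊔ˡ : ∀ {N₁ N₂ n} → N₁ ℕ.⊔ N₂ ℕ.≤ n → N₁ ℕ.≤ n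
  ≤-⊔ˡ {N₁} {N₂} = ℕₚ.≤-trans (ℕₚ.m≤m⊔n N₁ N₂)

  ≤-⊔ʳ : ∀ {N₁ N₂ n} → N₁ ℕ.⊔ N₂ ℕ.≤ n → N₂ ℕ.≤ n
  ≤-⊔ʳ {N₁} {N₂} = ℕₚ.≤-trans (ℕₚ.m≤n⊔m N₁ N₂)

  nonExpanding-cauchy : ∀ _∙_ → NonExpanding _∙_ → ∀ s t → IsCauchy s → IsCauchy t →
                        IsCauchy (λ n → s n ∙ t n)
  nonExpanding-cauchy _∙_ ne s t cs ct ε 0<ε
    with cs (½ ℚ.* ε) (0<½* 0<ε) | ct (½ ℚ.* ε) (0<½* 0<ε)
  ... | N₁ , h₁ | N₂ , h₂ = N₁ ℕ.⊔ N₂ , λ m n N≤m N≤n →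
    ℚₚ.≤-<-trans (ne (s m) (t m) (s n) (t n)) $
    subst (_ ℚ.<_) (½+½ ε) $
    ℚₚ.+-mono-< (h₁ m n (≤-⊔ˡ N≤m) (≤-⊔ˡ N≤n)) (h₂ m n (≤-⊔ʳ {N₁} N≤m) (≤-⊔ʳ {N₁} N≤n))

  const-cauchy : ∀ p → IsCauchy (λ _ → p)
  const-cauchy p ε 0<ε = 0 , λ _ _ _ _ → subst (ℚ._< ε) (sym (cong ℚ.∣_∣ (ℚₚ.+-inverseʳ p))) 0<ε

  neg-cauchy : ∀ s → IsCauchy s → IsCauchy (λ n → ℚ.- s n)
  neg-cauchy s cs ε 0<ε with cs ε 0<ε
  ... | N , h = N , λ m n N≤m N≤n → subst (ℚ._< ε)
    (trans (sym (ℚₚ.∣-p∣≡∣p∣ (s m ℚ.- s n))) (cong ℚ.∣_∣ (neg-diff (s m) (s n))))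
    (h m n N≤m N≤n)

  ∣∣-lipschitz : ∀ p q → ℚ.∣ ℚ.∣ p ∣ ℚ.- ℚ.∣ q ∣ ∣ ℚ.≤ ℚ.∣ p ℚ.- q ∣
  ∣∣-lipschitz p q = ∣-∣-close (half p q)
    (subst (λ d → ℚ.∣ q ∣ ℚ.≤ ℚ.∣ p ∣ ℚ.+ d) (∣p-q∣≡∣q-p∣ q p) (half q p))
    where
    half : ∀ a b → ℚ.∣ a ∣ ℚ.≤ ℚ.∣ b ∣ ℚ.+ ℚ.∣ a ℚ.- b ∣
    half a b = subst (λ c → ℚ.∣ c ∣ ℚ.≤ ℚ.∣ b ∣ ℚ.+ ℚ.∣ a ℚ.- b ∣) (shift a b)
      (ℚₚ.∣p+q∣≤∣p∣+∣q∣ b (a ℚ.- b))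

  ∣∣-cauchy : ∀ s → IsCauchy s → IsCauchy (λ n → ℚ.∣ s n ∣)
  ∣∣-cauchy s cs ε 0<ε with cs ε 0<ε
  ... | N , h = N , λ m n N≤m N≤n → ℚₚ.≤-<-trans (∣∣-lipschitz (s m) (s n)) (h m n N≤m N≤n)

  0<1 : 0ℚ ℚ.< 1ℚ
  0<1 = ℚₚ.positive⁻¹ 1ℚ

  bounded : ∀ s → IsCauchy s →
            ∃[ b ] 0ℚ ℚ.< b × ∃[ N ] ∀ n → N ℕ.≤ n → ℚ.∣ s n ∣ ℚ.≤ b
  bounded s cs with cs 1ℚ 0<1
  ... | N , h = ℚ.∣ s N ∣ ℚ.+ 1ℚ
    , ℚₚ.≤-<-trans (ℚₚ.0≤∣p∣ (s N)) (subst (ℚ._< ℚ.∣ s N ∣ ℚ.+ 1ℚ) (ℚₚ.+-identityʳ _) (ℚₚ.+-monoʳ-< ℚ.∣ s N ∣ 0<1))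
    , N , λ n N≤n → ℚₚ.≤-trans (p≤q+∣p-q∣ ℚ.∣ s n ∣ ℚ.∣ s N ∣)
        (ℚₚ.+-monoʳ-≤ ℚ.∣ s N ∣ (ℚₚ.≤-trans (∣∣-lipschitz (s n) (s N)) (ℚₚ.<⇒≤ (h n N N≤n ℕₚ.≤-refl))))

  divide : ∀ b ε → 0ℚ ℚ.< b → 0ℚ ℚ.< ε → ∃[ δ ] 0ℚ ℚ.< δ × b ℚ.* δ ≡ ε
  divide b ε 0<b 0<ε = δ , ℚₚ.positive⁻¹ δ {{ℚₚ.pos*pos⇒pos ε {{ℚ.positive 0<ε}} (ℚ.1/ b) {{ℚₚ.1/pos⇒pos b}}}} , eq
    where
    instance
      bpos : ℚ.Positive b
      bpos = ℚ.positive 0<b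
      bnz : ℚ.NonZero b
      bnz = ℚₚ.pos⇒nonZero b
    δ : ℚ
    δ = ε ℚ.* ℚ.1/ b
    open +-*-Solver
    eq : b ℚ.* δ ≡ ε
    eq = trans (solve 3 (λ b e i → b :* (e :* i) := e :* (b :* i)) refl b ε (ℚ.1/ b))
         (trans (cong (ε ℚ.*_) (ℚₚ.*-inverseʳ b)) (ℚₚ.*-identityʳ ε))

  *-bound : ∀ {p q b δ} → ℚ.∣ p ∣ ℚ.≤ b → ℚ.∣ q ∣ ℚ.< δ → 0ℚ ℚ.< b → ℚ.∣ p ℚ.* q ∣ ℚ.< b ℚ.* δ
  *-bound {p} {q} {b} {δ} p≤b q<δ 0<b = subst (ℚ._< b ℚ.* δ) (sym (ℚₚ.∣p*q∣≡∣p∣*∣q∣ p q)) $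
    ℚₚ.≤-<-trans (ℚₚ.*-monoʳ-≤-nonNeg ℚ.∣ q ∣ {{ℚₚ.∣-∣-nonNeg q}} p≤b)
                 (ℚₚ.*-monoʳ-<-pos b {{ℚ.positive 0<b}} q<δ)

  *-estimate : ∀ p q r s {b c δ₁ δ₂} → 0ℚ ℚ.< b → 0ℚ ℚ.< c → ℚ.∣ p ∣ ℚ.≤ b → ℚ.∣ s ∣ ℚ.≤ c →
               ℚ.∣ p ℚ.- r ∣ ℚ.< δ₁ → ℚ.∣ q ℚ.- s ∣ ℚ.< δ₂ →
               ℚ.∣ p ℚ.* q ℚ.- r ℚ.* s ∣ ℚ.< b ℚ.* δ₂ ℚ.+ c ℚ.* δ₁
  *-estimate p q r s {b} {c} {δ₁} {δ₂} 0<b 0<c p≤b s≤c pr qs =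
    subst (λ z → ℚ.∣ z ∣ ℚ.< b ℚ.* δ₂ ℚ.+ c ℚ.* δ₁) (prod-diff p q r s) $
    ℚₚ.≤-<-trans (ℚₚ.∣p+q∣≤∣p∣+∣q∣ (p ℚ.* (q ℚ.- s)) ((p ℚ.- r) ℚ.* s)) $
    ℚₚ.+-mono-< (*-bound p≤b qs 0<b)
      (subst (λ z → ℚ.∣ z ∣ ℚ.< c ℚ.* δ₁) (ℚₚ.*-comm s (p ℚ.- r)) (*-bound s≤c pr 0<c))

  *-cauchy : ∀ s t → IsCauchy s → IsCauchy t → IsCauchy (λ n → s n ℚ.* t n)
  *-cauchy s t cs ct ε 0<ε =
    let b , 0<b , N₁ , s≤b = bounded s cs
        c , 0<c , N₂ , t≤c = bounded t ct
        δ₁ , 0<δ₁ , cδ₁ = divide c (½ ℚ.* ε) 0<c (0<½* 0<ε)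
        δ₂ , 0<δ₂ , bδ₂ = divide b (½ ℚ.* ε) 0<b (0<½* 0<ε)
        N₃ , h₃ = cs δ₁ 0<δ₁
        N₄ , h₄ = ct δ₂ 0<δ₂
    in (N₁ ℕ.⊔ N₂) ℕ.⊔ (N₃ ℕ.⊔ N₄) , λ m n N≤m N≤n →
      subst (ℚ.∣ s m ℚ.* t m ℚ.- s n ℚ.* t n ∣ ℚ.<_) (trans (cong₂ ℚ._+_ bδ₂ cδ₁) (½+½ ε)) 
       (*-estimate (s m) (t m) (s n) (t n) {b} {c} {δ₁} {δ₂} 0<b 0<c
        (s≤b m (≤-⊔ˡ {N₁} {N₂} (≤-⊔ˡ {N₁ ℕ.⊔ N₂} {N₃ ℕ.⊔ N₄} N≤m)))
        (t≤c n (≤-⊔ʳ {N₁} {N₂} (≤-⊔ˡ {N₁ ℕ.⊔ N₂} {N₃ ℕ.⊔ N₄} N≤n)))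
        (h₃ m n (≤-⊔ˡ {N₃} {N₄} (≤-⊔ʳ {N₁ ℕ.⊔ N₂} N≤m)) (≤-⊔ˡ {N₃} {N₄} (≤-⊔ʳ {N₁ ℕ.⊔ N₂} N≤n)))
        (h₄ m n (≤-⊔ʳ {N₃} (≤-⊔ʳ {N₁ ℕ.⊔ N₂} N≤m)) (≤-⊔ʳ {N₃} (≤-⊔ʳ {N₁ ℕ.⊔ N₂} N≤n))))

infixl 6 _+_ _⊔_
infixl 7 _*_ _⊓_
infix  8 -_

fromℚ : ℚ → ℝ
fromℚ p = mkℝ (λ _ → p) (const-cauchy p)

0ℝ 1ℝ : ℝ
0ℝ = fromℚ 0ℚ
1ℝ = fromℚ 1ℚ

_+_ _*_ _⊔_ _⊓_ : ℝ → ℝ → ℝ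
x + y = mkℝ (λ n → seq x n ℚ.+ seq y n) (nonExpanding-cauchy ℚ._+_ +-nonExpanding (seq x) (seq y) (cauchy x) (cauchy y))
x * y = mkℝ (λ n → seq x n ℚ.* seq y n) (*-cauchy (seq x) (seq y) (cauchy x) (cauchy y))
x ⊔ y = mkℝ (λ n → seq x n ℚ.⊔ seq y n) (nonExpanding-cauchy ℚ._⊔_ ⊔-nonExpanding (seq x) (seq y) (cauchy x) (cauchy y))
x ⊓ y = mkℝ (λ n → seq x n ℚ.⊓ seq y n) (nonExpanding-cauchy ℚ._⊓_ ⊓-nonExpanding (seq x) (seq y) (cauchy x) (cauchy y))

-_ ∣_∣ : ℝ → ℝ
- x   = mkℝ (λ n → ℚ.- seq x n) (neg-cauchy (seq x) (cauchy x))
∣ x ∣ = mkℝ (λ n → ℚ.∣ seq x n ∣) (∣∣-cauchy (seq x) (cauchy x))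

ℝ-rawRing : RawRing 0ℓ 0ℓ
ℝ-rawRing = record
  { Carrier = ℝ
  ; _≈_     = _≃_
  ; _+_     = _+_
  ; _*_     = _*_
  ; -_      = -_
  ; 0#      = 0ℝ
  ; 1#      = 1ℝ
  }

open import Algebra.Definitions.RawSemiring (RawRing.rawSemiring ℝ-rawRing) public
  using (_^_; sum)

*-cong : ∀ {x x′ y y′} → x ≃ x′ → y ≃ y′ → x * y ≃ x′ * y′
*-cong {x} {x′} {y} {y′} x≃ y≃ ε 0<ε =
  let b , 0<b , N₁ , x≤b = bounded (seq x) (cauchy x)
      c , 0<c , N₂ , y≤c = bounded (seq y′) (cauchy y′)
      δ₁ , 0<δ₁ , cδ₁ = divide c (½ ℚ.* ε) 0<c (0<½* 0<ε)
      δ₂ , 0<δ₂ , bδ₂ = divide b (½ ℚ.* ε) 0<b (0<½* 0<ε)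
      N₃ , h₃ = x≃ δ₁ 0<δ₁
      N₄ , h₄ = y≃ δ₂ 0<δ₂
  in (N₁ ℕ.⊔ N₂) ℕ.⊔ (N₃ ℕ.⊔ N₄) , λ n N≤n →
    subst (ℚ.∣ seq x n ℚ.* seq y n ℚ.- seq x′ n ℚ.* seq y′ n ∣ ℚ.<_)
      (trans (cong₂ ℚ._+_ bδ₂ cδ₁) (½+½ ε))
      (*-estimate (seq x n) (seq y n) (seq x′ n) (seq y′ n) {b} {c} {δ₁} {δ₂} 0<b 0<c
        (x≤b n (≤-⊔ˡ {N₁} {N₂} (≤-⊔ˡ {N₁ ℕ.⊔ N₂} {N₃ ℕ.⊔ N₄} N≤n)))
        (y≤c n (≤-⊔ʳ {N₁} {N₂} (≤-⊔ˡ {N₁ ℕ.⊔ N₂} {N₃ ℕ.⊔ N₄} N≤n)))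
        (h₃ n (≤-⊔ˡ {N₃} {N₄} (≤-⊔ʳ {N₁ ℕ.⊔ N₂} N≤n)))
        (h₄ n (≤-⊔ʳ {N₃} (≤-⊔ʳ {N₁ ℕ.⊔ N₂} N≤n))))

^-cong : ∀ k {x y} → x ≃ y → x ^ k ≃ y ^ k
^-cong zero            x≃y = λ ε 0<ε → proj₁ (const-cauchy 1ℚ ε 0<ε) , λ n N≤n → proj₂ (const-cauchy 1ℚ ε 0<ε) n n N≤n N≤n
^-cong (suc k) {x} {y} x≃y = *-cong {x} {y} {x ^ k} {y ^ k} x≃y (^-cong k {x} {y} x≃y)

open import Algebra.Definitions.RawSemiring ℚ.+-*-rawSemiring using () renaming (_^_ to _^ℚ_)

private

  ≤⇒≯ : ∀ {p q} → p ℚ.≤ q → ¬ q ℚ.< p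
  ≤⇒≯ p≤q q<p = ℚₚ.<-irrefl refl (ℚₚ.<-≤-trans q<p p≤q)

  greatest : (ℕ → Bool) → ℕ → ℕ
  greatest p zero    = zero
  greatest p (suc b) = if p (suc b) then suc b else greatest p b

  greatest-true : ∀ (p : ℕ → Bool) b → T (p 0) → T (p (greatest p b))
  greatest-true p zero    p0 = p0
  greatest-true p (suc b) p0 with p (suc b) in eq
  ... | true  = subst T (sym eq) tt
  ... | false = greatest-true p b p0

  greatest-false : ∀ (p : ℕ → Bool) b → ¬ T (p (suc b)) → ¬ T (p (suc (greatest p b)))
  greatest-false p zero    ¬p = ¬p
  greatest-false p (suc b) ¬p with p (suc b) in eq
  ... | true  = ¬p
  ... | false = greatest-false p b (subst T eq)

  grid : ℕ → ℕ → ℚ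
  grid n j = + j ℚ./ suc n

  toℚᵘ-grid : ∀ n j → ℚ.toℚᵘ (grid n j) ℚᵘ.≃ ℚᵘ.mkℚᵘ (+ j) n
  toℚᵘ-grid n j = ℚₚ.toℚᵘ-fromℚᵘ (ℚᵘ.mkℚᵘ (+ j) n)

  grid-suc : ∀ n j → grid n (suc j) ≡ grid n j ℚ.+ grid n 1
  grid-suc n j = ℚₚ.toℚᵘ-injective $ begin
    ℚ.toℚᵘ (grid n (suc j))                   ≈⟨ toℚᵘ-grid n (suc j) ⟩
    ℚᵘ.mkℚᵘ (+ suc j) n                       ≈⟨ ℚᵘ.*≡* (solve 2 (λ a b → (con (+ 1) :+ a) :* (b :* b) := (a :* b :+ con (+ 1) :* b) :* b) refl (+ j) (+ suc n)) ⟩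
    ℚᵘ.mkℚᵘ (+ j) n ℚᵘ.+ ℚᵘ.mkℚᵘ (+ 1) n      ≈⟨ ℚᵘₚ.+-cong (toℚᵘ-grid n j) (toℚᵘ-grid n 1) ⟨
    ℚ.toℚᵘ (grid n j) ℚᵘ.+ ℚ.toℚᵘ (grid n 1)  ≈⟨ ℚₚ.toℚᵘ-homo-+ (grid n j) (grid n 1) ⟨
    ℚ.toℚᵘ (grid n j ℚ.+ grid n 1)            ∎
    where
    open ℚᵘₚ.≃-Reasoning
    open ℤ-Solver

  grid-mono : ∀ {n j q} → q ℚᵘ.≤ ℚᵘ.mkℚᵘ (+ j) n → q ℚᵘ.≤ ℚ.toℚᵘ (grid n j)
  grid-mono {n} {j} q≤ = ℚᵘₚ.≤-respʳ-≃ (ℚᵘₚ.≃-sym (toℚᵘ-grid n j)) q≤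

  ≤-grid : ∀ n q → 0ℚ ℚ.≤ q → q ℚ.≤ grid n (suc n ℕ.* suc ℤ.∣ ↥ q ∣)
  ≤-grid n (mkℚ (+ a) d c) 0≤q = ℚₚ.toℚᵘ-cancel-≤ $ grid-mono {n} {suc n ℕ.* suc a} $ ℚᵘ.*≤* $
    subst₂ ℤ._≤_ (ℤₚ.pos-* a (suc n)) (ℤₚ.pos-* (suc n ℕ.* suc a) (suc d)) $ ℤ.+≤+ $ ≤ℕ
    where
    open ℕₚ.≤-Reasoning
    ≤ℕ : a ℕ.* suc n ℕ.≤ suc n ℕ.* suc a ℕ.* suc d
    ≤ℕ = begin
      a ℕ.* suc n               ≡⟨ ℕₚ.*-comm a (suc n) ⟩
      suc n ℕ.* a               ≤⟨ ℕₚ.*-monoʳ-≤ (suc n) (ℕₚ.n≤1+n a) ⟩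
      suc n ℕ.* suc a           ≤⟨ ℕₚ.m≤m*n (suc n ℕ.* suc a) (suc d) ⟩
      suc n ℕ.* suc a ℕ.* suc d ∎
  ≤-grid n (mkℚ ℤ.-[1+ a ] d c) 0≤q = contradiction (ℚₚ.negative⁻¹ (mkℚ ℤ.-[1+ a ] d c)) (≤⇒≯ 0≤q)

  1≤grid : ∀ n a → 1ℚ ℚ.≤ grid n (suc n ℕ.* suc a)
  1≤grid n a = ℚₚ.toℚᵘ-cancel-≤ $ grid-mono {n} {suc n ℕ.* suc a} $ ℚᵘ.*≤* $
    subst₂ ℤ._≤_ (sym (ℤₚ.*-identityˡ (+ suc n))) (sym (ℤₚ.*-identityʳ (+ (suc n ℕ.* suc a)))) $
    ℤ.+≤+ (ℕₚ.m≤m*n (suc n) (suc a))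

  0<grid-suc : ∀ n j → 0ℚ ℚ.< grid n (suc j)
  0<grid-suc n j = ℚₚ.positive⁻¹ (grid n (suc j)) {{ℚₚ.normalize-pos (suc j) (suc n)}}

  0≤grid : ∀ n j → 0ℚ ℚ.≤ grid n j
  0≤grid n j = ℚₚ.nonNegative⁻¹ (grid n j) {{ℚₚ.normalize-nonNeg j (suc n)}}

  grid-small : ∀ ε → 0ℚ ℚ.< ε → ∃[ N ] ∀ n → N ℕ.≤ n → grid n 1 ℚ.< ε
  grid-small (mkℚ (+ suc e) d c) _ = suc d , λ n N≤n →
    ℚₚ.toℚᵘ-cancel-< $ ℚᵘₚ.<-respˡ-≃ (ℚᵘₚ.≃-sym (toℚᵘ-grid n 1)) $ ℚᵘ.*<* $
    subst₂ ℤ._<_ (sym (ℤₚ.*-identityˡ (+ suc d))) (ℤₚ.pos-* (suc e) (suc n)) $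
    ℤ.+<+ (ℕₚ.≤-trans (s≤s N≤n) (ℕₚ.m≤m+n (suc n) (e ℕ.* suc n)))
  grid-small (mkℚ (+ zero) d c) (ℚ.*<* (ℤ.+<+ 0<0)) = contradiction 0<0 λ ()
  grid-small (mkℚ ℤ.-[1+ e ] d c) 0<ε = contradiction 0<ε (ℚₚ.<-asym (ℚₚ.negative⁻¹ (mkℚ ℤ.-[1+ e ] d c)))

  0≤^ : ∀ {p} k → 0ℚ ℚ.≤ p → 0ℚ ℚ.≤ p ^ℚ k
  0≤^ zero        0≤p = ℚₚ.<⇒≤ 0<1
  0≤^ {p} (suc k) 0≤p = ℚₚ.nonNegative⁻¹ _
    {{ℚₚ.nonNeg*nonNeg⇒nonNeg p {{ℚ.nonNegative 0≤p}} (p ^ℚ k) {{ℚ.nonNegative (0≤^ k 0≤p)}}}}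

  0<^ : ∀ {p} k → 0ℚ ℚ.< p → 0ℚ ℚ.< p ^ℚ k
  0<^ zero        0<p = 0<1
  0<^ {p} (suc k) 0<p = ℚₚ.positive⁻¹ _
    {{ℚₚ.pos*pos⇒pos p {{ℚ.positive 0<p}} (p ^ℚ k) {{ℚ.positive (0<^ k 0<p)}}}}

  *-mono-≤ : ∀ {p q r s} → 0ℚ ℚ.≤ p → 0ℚ ℚ.≤ s → p ℚ.≤ q → r ℚ.≤ s → p ℚ.* r ℚ.≤ q ℚ.* s
  *-mono-≤ {p} {q} {r} {s} 0≤p 0≤s p≤q r≤s = ℚₚ.≤-trans
    (ℚₚ.*-monoˡ-≤-nonNeg p {{ℚ.nonNegative 0≤p}} r≤s)
    (ℚₚ.*-monoʳ-≤-nonNeg s {{ℚ.nonNegative 0≤s}} p≤q)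

  ^-mono : ∀ {p q} k → 0ℚ ℚ.≤ p → p ℚ.≤ q → p ^ℚ k ℚ.≤ q ^ℚ k
  ^-mono zero    0≤p p≤q = ℚₚ.≤-refl
  ^-mono (suc k) 0≤p p≤q = *-mono-≤ 0≤p (0≤^ k (ℚₚ.≤-trans 0≤p p≤q)) p≤q (^-mono k 0≤p p≤q)

  ≤-^ : ∀ {p} k → 1ℚ ℚ.≤ p → p ℚ.≤ p ^ℚ suc k
  ≤-^ {p} k 1≤p = subst (ℚ._≤ p ^ℚ suc k) (ℚₚ.*-identityʳ p)
    (ℚₚ.*-monoˡ-≤-nonNeg p {{ℚ.nonNegative (ℚₚ.≤-trans (ℚₚ.<⇒≤ 0<1) 1≤p)}}
      (subst (ℚ._≤ p ^ℚ k) (1^ k) (^-mono k (ℚₚ.<⇒≤ 0<1) 1≤p)))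
    where
    1^ : ∀ j → 1ℚ ^ℚ j ≡ 1ℚ
    1^ zero    = refl
    1^ (suc j) = trans (ℚₚ.*-identityˡ (1ℚ ^ℚ j)) (1^ j)

  p≤p+q : ∀ p {q} → 0ℚ ℚ.≤ q → p ℚ.≤ p ℚ.+ q
  p≤p+q p {q} 0≤q = subst (ℚ._≤ p ℚ.+ q) (ℚₚ.+-identityʳ p) (ℚₚ.+-monoʳ-≤ p 0≤q)

  0≤+ : ∀ {p q} → 0ℚ ℚ.≤ p → 0ℚ ℚ.≤ q → 0ℚ ℚ.≤ p ℚ.+ q
  0≤+ {p} 0≤p 0≤q = ℚₚ.≤-trans 0≤p (p≤p+q p 0≤q)

  0≤* : ∀ {p q} → 0ℚ ℚ.≤ p → 0ℚ ℚ.≤ q → 0ℚ ℚ.≤ p ℚ.* q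
  0≤* {p} {q} 0≤p 0≤q = ℚₚ.nonNegative⁻¹ _
    {{ℚₚ.nonNeg*nonNeg⇒nonNeg p {{ℚ.nonNegative 0≤p}} q {{ℚ.nonNegative 0≤q}}}}

  ^-superadditive : ∀ {p q} k → 0ℚ ℚ.≤ p → 0ℚ ℚ.≤ q →
                    p ^ℚ suc k ℚ.+ q ^ℚ suc k ℚ.≤ (p ℚ.+ q) ^ℚ suc k
  ^-superadditive {p} {q} zero    0≤p 0≤q = ℚₚ.≤-reflexive (sym (ℚₚ.*-distribʳ-+ 1ℚ p q))
  ^-superadditive {p} {q} (suc k) 0≤p 0≤q = ℚₚ.≤-trans
    (subst (p ℚ.* P ℚ.+ q ℚ.* Q ℚ.≤_) expand (p≤p+q (p ℚ.* P ℚ.+ q ℚ.* Q)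
      (0≤+ (0≤* 0≤p (0≤^ (suc k) 0≤q)) (0≤* 0≤q (0≤^ (suc k) 0≤p)))))
    (ℚₚ.*-monoˡ-≤-nonNeg (p ℚ.+ q) {{ℚ.nonNegative (0≤+ 0≤p 0≤q)}} (^-superadditive k 0≤p 0≤q))
    where
    P Q : ℚ
    P = p ^ℚ suc k
    Q = q ^ℚ suc k
    open +-*-Solver
    expand : (p ℚ.* P ℚ.+ q ℚ.* Q) ℚ.+ (p ℚ.* Q ℚ.+ q ℚ.* P) ≡ (p ℚ.+ q) ℚ.* (P ℚ.+ Q)
    expand = solve 4 (λ p q P Q → (p :* P :+ q :* Q) :+ (p :* Q :+ q :* P) := (p :+ q) :* (P :+ Q)) refl p q P Q

-- The largest multiple of 1/(n + 1) whose k-th power is at most q.  The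
-- search bound is large enough by rootApprox-upper (for k > 0).
rootApprox : ℕ → ℕ → ℚ → ℚ
rootApprox k n q = grid n (greatest (λ j → grid n j ^ℚ k ℚ.≤ᵇ q) (suc n ℕ.* suc ℤ.∣ ↥ q ∣))

rootApprox-nonNeg : ∀ k n q → 0ℚ ℚ.≤ rootApprox k n q
rootApprox-nonNeg k n q = 0≤grid n (greatest (λ j → grid n j ^ℚ k ℚ.≤ᵇ q) (suc n ℕ.* suc ℤ.∣ ↥ q ∣))

rootApprox-lower : ∀ k n q → .{{ℕ.NonZero k}} → 0ℚ ℚ.≤ q → rootApprox k n q ^ℚ k ℚ.≤ q
rootApprox-lower k@(suc k-1) n q 0≤q = ℚₚ.≤ᵇ⇒≤ {rootApprox k n q ^ℚ k} {q} $
  greatest-true (λ j → grid n j ^ℚ k ℚ.≤ᵇ q) (suc n ℕ.* suc ℤ.∣ ↥ q ∣) $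
  ℚₚ.≤⇒≤ᵇ {grid n 0 ^ℚ k} {q} (subst (ℚ._≤ q) (sym 0^) 0≤q)
  where
  0^ : grid n 0 ^ℚ k ≡ 0ℚ
  0^ = trans (cong (ℚ._* (grid n 0 ^ℚ k-1)) (ℚₚ.0/n≡0 (suc n))) (ℚₚ.*-zeroˡ (grid n 0 ^ℚ k-1))

rootApprox-upper : ∀ k n q → .{{ℕ.NonZero k}} → 0ℚ ℚ.≤ q →
                   q ℚ.< (rootApprox k n q ℚ.+ + 1 ℚ./ suc n) ^ℚ k
rootApprox-upper k@(suc k-1) n q 0≤q = subst (λ r → q ℚ.< r ^ℚ k) (grid-suc n g) $
  ℚₚ.≰⇒> λ ≤q → greatest-false P b
    (λ ≤ᵇq → ≤⇒≯ (ℚₚ.≤ᵇ⇒≤ {grid n (suc b) ^ℚ k} {q} ≤ᵇq) q<)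
    (ℚₚ.≤⇒≤ᵇ {grid n (suc g) ^ℚ k} {q} ≤q)
  where
  P : ℕ → Bool
  P j = grid n j ^ℚ k ℚ.≤ᵇ q
  b g : ℕ
  b = suc n ℕ.* suc ℤ.∣ ↥ q ∣
  g = greatest P b
  b<1+b : grid n b ℚ.< grid n (suc b)
  b<1+b = subst₂ ℚ._<_ (ℚₚ.+-identityʳ (grid n b)) (sym (grid-suc n b)) (ℚₚ.+-monoʳ-< (grid n b) (0<grid-suc n 0))
  q< : q ℚ.< grid n (suc b) ^ℚ k
  q< = ℚₚ.≤-<-trans {q} {grid n b} (≤-grid n q 0≤q) $
       ℚₚ.<-≤-trans {grid n b} {grid n (suc b)} b<1+b $
       ≤-^ {grid n (suc b)} k-1 (ℚₚ.≤-trans {1ℚ} {grid n b} (1≤grid n ℤ.∣ ↥ q ∣) (ℚₚ.<⇒≤ b<1+b))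

private

  root-close : ∀ k {a b δ ε p q} → 0ℚ ℚ.≤ a → 0ℚ ℚ.≤ b → 0ℚ ℚ.≤ δ → 0ℚ ℚ.< ε → δ ℚ.< ½ ℚ.* ε →
               a ^ℚ suc k ℚ.≤ p → q ℚ.< (b ℚ.+ δ) ^ℚ suc k → p ℚ.≤ q ℚ.+ (½ ℚ.* ε) ^ℚ suc k →
               a ℚ.< b ℚ.+ ε
  root-close k {a} {b} {δ} {ε} {p} {q} 0≤a 0≤b 0≤δ 0<ε δ<½ε aᵏ≤p q<bᵏ p≤ =
    ℚₚ.≰⇒> λ b+ε≤a → ≤⇒≯ aᵏ≤p (begin-strict
      p                                   ≤⟨ p≤ ⟩
      q ℚ.+ h ^ℚ suc k                    <⟨ ℚₚ.+-monoˡ-< (h ^ℚ suc k) q<bᵏ ⟩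
      (b ℚ.+ δ) ^ℚ suc k ℚ.+ h ^ℚ suc k   ≤⟨ ^-superadditive k 0≤b+δ 0≤h ⟩
      (b ℚ.+ δ ℚ.+ h) ^ℚ suc k            ≤⟨ ^-mono (suc k) (0≤+ 0≤b+δ 0≤h) (ℚₚ.≤-trans b+δ+h≤b+ε b+ε≤a) ⟩
      a ^ℚ suc k                          ∎)
    where
    open ℚₚ.≤-Reasoning
    h : ℚ
    h = ½ ℚ.* ε
    0≤h : 0ℚ ℚ.≤ h
    0≤h = ℚₚ.<⇒≤ (0<½* 0<ε)
    0≤b+δ : 0ℚ ℚ.≤ b ℚ.+ δ
    0≤b+δ = 0≤+ 0≤b 0≤δ
    b+δ+h≤b+ε : b ℚ.+ δ ℚ.+ h ℚ.≤ b ℚ.+ ε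
    b+δ+h≤b+ε = subst (b ℚ.+ δ ℚ.+ h ℚ.≤_)
      (trans (ℚₚ.+-assoc b h h) (cong (b ℚ.+_) (½+½ ε)))
      (ℚₚ.+-monoˡ-≤ h (ℚₚ.+-monoʳ-≤ b (ℚₚ.<⇒≤ δ<½ε)))

  ∣-∣-close-< : ∀ {p q δ} → p ℚ.< q ℚ.+ δ → q ℚ.< p ℚ.+ δ → ℚ.∣ p ℚ.- q ∣ ℚ.< δ
  ∣-∣-close-< {p} {q} {δ} p< q< with ℚₚ.∣p∣≡p∨∣p∣≡-p (p ℚ.- q)
  ... | inj₁ eq = subst (ℚ._< δ) (sym eq) (move p<)
    where
    open +-*-Solver
    move : ∀ {a b} → a ℚ.< b ℚ.+ δ → a ℚ.- b ℚ.< δ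
    move {a} {b} a< = subst (a ℚ.- b ℚ.<_)
      (solve 2 (λ b d → (b :+ d) :- b := d) refl b δ) (ℚₚ.+-monoˡ-< (ℚ.- b) a<)
  ... | inj₂ eq = subst (ℚ._< δ) (sym (trans eq (flip-neg p q))) (move q<)
    where
    open +-*-Solver
    move : ∀ {a b} → a ℚ.< b ℚ.+ δ → a ℚ.- b ℚ.< δ
    move {a} {b} a< = subst (a ℚ.- b ℚ.<_)
      (solve 2 (λ b d → (b :+ d) :- b := d) refl b δ) (ℚₚ.+-monoˡ-< (ℚ.- b) a<)

  root-cauchy : ∀ k → .{{ℕ.NonZero k}} → ∀ s → IsCauchy s → IsCauchy (λ n → rootApprox k n ℚ.∣ s n ∣)
  root-cauchy k@(suc k-1) s cs ε 0<ε =
    let N₁ , h₁ = cs ((½ ℚ.* ε) ^ℚ k) (0<^ k (0<½* 0<ε))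
        N₂ , h₂ = grid-small (½ ℚ.* ε) (0<½* 0<ε)
        close : ∀ m n → N₁ ℕ.⊔ N₂ ℕ.≤ m → N₁ ℕ.⊔ N₂ ℕ.≤ n →
                rootApprox k m ℚ.∣ s m ∣ ℚ.< rootApprox k n ℚ.∣ s n ∣ ℚ.+ ε
        close m n N≤m N≤n = root-close k-1 {δ = grid n 1} {p = ℚ.∣ s m ∣} {q = ℚ.∣ s n ∣}
          (rootApprox-nonNeg k m ℚ.∣ s m ∣) (rootApprox-nonNeg k n ℚ.∣ s n ∣) (0≤grid n 1) 0<ε
          (h₂ n (≤-⊔ʳ {N₁} {N₂} N≤n))
          (rootApprox-lower k m ℚ.∣ s m ∣ (ℚₚ.0≤∣p∣ (s m)))
          (rootApprox-upper k n ℚ.∣ s n ∣ (ℚₚ.0≤∣p∣ (s n)))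
          (ℚₚ.≤-trans (p≤q+∣p-q∣ ℚ.∣ s m ∣ ℚ.∣ s n ∣)
            (ℚₚ.+-monoʳ-≤ ℚ.∣ s n ∣ (ℚₚ.≤-trans (∣∣-lipschitz (s m) (s n))
              (ℚₚ.<⇒≤ (h₁ m n (≤-⊔ˡ {N₁} {N₂} N≤m) (≤-⊔ˡ {N₁} {N₂} N≤n))))))
    in N₁ ℕ.⊔ N₂ , λ m n N≤m N≤n → ∣-∣-close-< (close m n N≤m N≤n) (close n m N≤n N≤m)

-- The nonnegative k-th root of ∣ x ∣, characterised by 0≤root and root-^.
root : ∀ k → .{{ℕ.NonZero k}} → ℝ → ℝ
root k x = mkℝ (λ n → rootApprox k n ℚ.∣ seq x n ∣) (root-cauchy k (seq x) (cauchy x))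

0≤root : ∀ k → .{{_ : ℕ.NonZero k}} → ∀ x → 0ℝ ≤ root k x
0≤root k x ε 0<ε = 0 , λ n _ → 0≤+ (rootApprox-nonNeg k n ℚ.∣ seq x n ∣) (ℚₚ.<⇒≤ 0<ε)

private

  seq-^ : ∀ x k n → seq (x ^ k) n ≡ seq x n ^ℚ k
  seq-^ x zero    n = refl
  seq-^ x (suc k) n = cong (seq x n ℚ.*_) (seq-^ x k n)

  grid-cauchy : IsCauchy (λ n → grid n 1)
  grid-cauchy ε 0<ε =
    let N , h = grid-small ε 0<ε
    in N , λ m n N≤m N≤n → ∣-∣-close-<
      (ℚₚ.<-≤-trans (h m N≤m) (subst (ε ℚ.≤_) (ℚₚ.+-comm ε (grid n 1)) (p≤p+q ε (0≤grid n 1))))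
      (ℚₚ.<-≤-trans (h n N≤n) (subst (ε ℚ.≤_) (ℚₚ.+-comm ε (grid m 1)) (p≤p+q ε (0≤grid m 1))))

root-^ : ∀ k → .{{_ : ℕ.NonZero k}} → ∀ x → root k x ^ k ≃ ∣ x ∣
root-^ k x ε 0<ε =
  let N , h = ^-cong k {upper} {root k x} upper≃ ε 0<ε
  in N , λ n N≤n →
    let q   = ℚ.∣ seq x n ∣
        r   = rootApprox k n q
        low : r ^ℚ k ℚ.≤ q
        low = rootApprox-lower k n q (ℚₚ.0≤∣p∣ (seq x n))
        high : q ℚ.< (r ℚ.+ grid n 1) ^ℚ k
        high = rootApprox-upper k n q (ℚₚ.0≤∣p∣ (seq x n))
        near : ℚ.∣ (r ℚ.+ grid n 1) ^ℚ k ℚ.- r ^ℚ k ∣ ℚ.< ε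
        near = subst₂ (λ u v → ℚ.∣ u ℚ.- v ∣ ℚ.< ε) (seq-^ upper k n) (seq-^ (root k x) k n) (h n N≤n)
    in subst (λ u → ℚ.∣ u ℚ.- q ∣ ℚ.< ε) (sym (seq-^ (root k x) k n)) $
       ∣-∣-close-<
         (ℚₚ.≤-<-trans low (subst (ℚ._< q ℚ.+ ε) (ℚₚ.+-identityʳ q) (ℚₚ.+-monoʳ-< q 0<ε)))
         (ℚₚ.<-trans high (ℚₚ.≤-<-trans (p≤q+∣p-q∣ ((r ℚ.+ grid n 1) ^ℚ k) (r ^ℚ k)) (ℚₚ.+-monoʳ-< (r ^ℚ k) near)))
  where
  upper : ℝ
  upper = mkℝ (λ n → seq (root k x) n ℚ.+ grid n 1)
    (nonExpanding-cauchy ℚ._+_ +-nonExpanding (seq (root k x)) (λ n → grid n 1) (cauchy (root k x)) grid-cauchy)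
  upper≃ : upper ≃ root k x
  upper≃ ε 0<ε =
    let N , h = grid-small ε 0<ε
    in N , λ n N≤n → ∣-∣-close-<
      (ℚₚ.+-monoʳ-< (seq (root k x) n) (h n N≤n))
      (subst (ℚ._< seq upper n ℚ.+ ε) (ℚₚ.+-identityʳ (seq (root k x) n))
        (ℚₚ.+-mono-≤-< (p≤p+q (seq (root k x) n) (0≤grid n 1)) 0<ε))

√ : ℝ → ℝ
√ = root 2

Matrix : ∀ {a} → Set a → ℕ → ℕ → Set a
Matrix A m n = Fin m → Fin n → A

submatrix : ∀ {a} {A : Set a} {m n k l} → Matrix A m n → Vector (Fin m) k → Vector (Fin n) l → Matrix A k l
submatrix A rows cols i j = A (rows i) (cols j)

module Determinant {c ℓ} (R : RawRing c ℓ) where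
  private module R = RawRing R
  open import Algebra.Definitions.RawSemiring R.rawSemiring
    using () renaming (sum to ∑; _^_ to _^ᴿ_)

  -- Laplace expansion along the first row.
  det : ∀ {n} → Matrix R.Carrier n n → R.Carrier
  det {zero}  A = R.1#
  det {suc n} A = ∑ λ j →
    ((R.- R.1#) ^ᴿ toℕ j) R.* (A Fin.zero j R.* det (λ a b → A (Fin.suc a) (punchIn j b)))

open Determinant ℝ-rawRing public using (det)

-- All strictly increasing k-tuples in Fin n, i.e. the k-element subsets.
selections : ∀ k n → List (Vector (Fin n) k)
selections zero    n       = [ (λ ()) ]
selections (suc k) zero    = []
selections (suc k) (suc n) =
  List.map (λ s → Fin.zero ∷ (Fin.suc ∘ s)) (selections k n) ++
  List.map (Fin.suc ∘_) (selections (suc k) n)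

-- Maximum of nonnegative reals f x, x ∈ xs; the base case 0 never matters
-- below, where f is nonnegative and xs nonempty.
max : ∀ {a} {A : Set a} → List A → (A → ℝ) → ℝ
max xs f = List.foldr (λ x m → f x ⊔ m) 0ℝ xs

min⁺ : ∀ {a} {A : Set a} → List⁺ A → (A → ℝ) → ℝ
min⁺ xs f = List⁺.foldr₁ _⊓_ (List⁺.map f xs)

fromSign : Sign → ℝ
fromSign Sign.+ = 1ℝ
fromSign Sign.- = - 1ℝ

signings : ∀ n → List⁺ (Vector Sign n)
signings zero    = List⁺.[ (λ ()) ]
signings (suc n) = List⁺.map (Sign.+ ∷_) (signings n) ⁺++⁺ List⁺.map (Sign.- ∷_) (signings n)

_·_ : ∀ {m n} → Matrix ℝ m n → Vector ℝ n → Vector ℝ m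
(A · x) i = sum λ j → A i j * x j

‖_‖∞ : ∀ {m} → Vector ℝ m → ℝ
‖ y ‖∞ = max (List.allFin _) λ i → ∣ y i ∣

disc : ∀ {m n} → Matrix ℝ m n → ℝ
disc {n = n} A = min⁺ (signings n) λ x → ‖ A · (fromSign ∘ x) ‖∞

-- Submatrices have suc k rows and suc l columns because upTo starts at 0;
-- likewise in detlb.
herdisc : ∀ {m n} → Matrix ℝ m n → ℝ
herdisc {m} {n} A =
  max (upTo m) λ k → max (upTo n) λ l →
  max (selections (suc k) m) λ rows → max (selections (suc l) n) λ cols →
  disc (submatrix A rows cols)

detlb : ∀ {m n} → Matrix ℝ m n → ℝ
detlb {m} {n} A =
  max (upTo (m ℕ.⊓ n)) λ k →
  max (selections (suc k) m) λ rows → max (selections (suc k) n) λ cols →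
  root (suc k) ∣ det (submatrix A rows cols) ∣

fromℕ : ℕ → ℝ
fromℕ n = fromℚ (+ n ℚ./ 1)

{-# OPTIONS --safe #-}
-- Fix an index N into the Cauchy sequences: the N-th terms of herdisc and detlb
-- are then computed from the rational matrix of the N-th terms of the entries,
-- and detlb gives a D > 0 with ∣det B∣ ≤ Dᵏ for all k × k submatrices B.
--
-- Choose rows greedily, keeping a row if its distance to the span of the rows
-- kept so far exceeds 4 D.  The wedge product ω of the k kept rows has
-- ∣ω∣² ≥ (16 D²)ᵏ; but its coefficients are minors, so ∣ω∣² ≤ 2ⁿ D²ᵏ, and
-- k ≤ n/4.  Every row a then satisfies ∣a · x∣ ≤ 4 D ∣x∣ for all x orthogonal to
-- the kept rows.  Linear algebra moves a point of the cube [-1, 1]ⁿ orthogonally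
-- to the kept rows until at most n/4 coordinates differ from ±1, at a cost of at
-- most 8 D √n in every row.  Repeating this on the remaining columns gives a
-- geometric series with sum 16 D √n.
module Submission where

open import Algebra.Bundles using (module Ring)
open import Data.Fin.Base as Fin using (Fin; zero; suc; toℕ; punchIn; punchOut)
import Data.Fin.Properties as Finₚ
open import Data.Fin.Subset using (Subset; inside; outside)
open import Data.Nat.Base as ℕ using (ℕ; zero; suc; z≤n; s≤s)
import Data.Nat.Properties as ℕₚ
open import Data.Product.Base using (∃-syntax; _×_; _,_; proj₁; proj₂)
import Data.Rational.Base as ℚ
import Data.Rational.Properties as ℚₚ
open import Data.Sign.Base as Sign using (Sign)
open import Data.Sum.Base using (_⊎_; inj₁; inj₂)
open import Data.Vec.Base using ([]; _∷_)
open import Data.Vec.Functional as Vector using (Vector)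
open import Data.Vec.Functional.Properties using (insertAt-lookup; insertAt-punchIn)
open import Defs using (Matrix; submatrix; module Determinant)
open import Function.Base using (_∘_; _$_; id)
open import Relation.Binary.Definitions using (tri<; tri≈; tri>)
open import Relation.Binary.PropositionalEquality
  using (_≡_; _≢_; _≗_; refl; sym; trans; cong; cong₂; subst; subst₂; module ≡-Reasoning)
open import Relation.Nullary.Decidable using (yes; no; ¬?; decidable-stable; dec⇒maybe; toWitness)
open import Relation.Nullary.Negation using (contradiction)
open import Tactic.RingSolver using (solve-∀)
import Tactic.RingSolver.Core.AlmostCommutativeRing as ACR

open import Algebra.Definitions.RawSemiring ℚ.+-*-rawSemiring using () renaming (_^_ to _^ℚ_; _×_ to _×ℚ_; sum to sumℚ)
open import Algebra.Properties.CommutativeMonoid.Sum ℚₚ.+-0-commutativeMonoid using (sum-cong-≗; sum-remove)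
open import Algebra.Properties.Semiring.Sum (Ring.semiring ℚₚ.+-*-ring) using (*-distribˡ-sum)
open Determinant ℚ.+-*-rawRing using () renaming (det to detℚ)

ℚ-ring : ACR.AlmostCommutativeRing _ _
ℚ-ring = ACR.fromCommutativeRing ℚₚ.+-*-commutativeRing λ p → dec⇒maybe (ℚ.0ℚ ℚₚ.≟ p)

-- Linear functionals and the exterior algebra of ℚⁿ

module _ where
  open import Data.Rational.Base
  open import Data.Rational.Properties
  open ≡-Reasoning

  p0+q0 : ∀ p q → 0ℚ ≡ p * 0ℚ + q * 0ℚ
  p0+q0 = solve-∀ ℚ-ring

  0p+0p : ∀ p → 0ℚ ≡ 0ℚ * p + 0ℚ * p
  0p+0p = solve-∀ ℚ-ring

  pq-r : ∀ p q r → p * q - r ≡ p * q + - 1ℚ * r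
  pq-r = solve-∀ ℚ-ring

  -- The linearity lemmas take combinations of two terms, so a lone term is padded with one of
  -- coefficient `0ℚ`.
  -p : ∀ p → - p ≡ - 1ℚ * p + 0ℚ * p
  -p = solve-∀ ℚ-ring

  dot : ∀ {n} → Vector ℚ n → Vector ℚ n → ℚ
  dot a x = sumℚ λ j → a j * x j

  dot-linearʳ : ∀ {n} (a : Vector ℚ n) p q {x y z : Vector ℚ n} → (∀ j → z j ≡ p * x j + q * y j) →
                dot a z ≡ p * dot a x + q * dot a y
  dot-linearʳ {zero}  a p q z≡ = p0+q0 p q
  dot-linearʳ {suc n} a p q {x} {y} z≡ = trans
    (cong₂ (λ u v → a zero * u + v) (z≡ zero) (dot-linearʳ (a ∘ suc) p q (z≡ ∘ suc)))
    (lemma p q (a zero) (x zero) (y zero) (dot (a ∘ suc) (x ∘ suc)) (dot (a ∘ suc) (y ∘ suc)))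
    where
    lemma : ∀ p q a x y s t → a * (p * x + q * y) + (p * s + q * t) ≡ p * (a * x + s) + q * (a * y + t)
    lemma = solve-∀ ℚ-ring

  dot-comm : ∀ {n} (a x : Vector ℚ n) → dot a x ≡ dot x a
  dot-comm a x = sum-cong-≗ λ j → *-comm (a j) (x j)

  -- An element of the exterior algebra of ℚⁿ: a Subset S stands for the
  -- basis vector e_S, the wedge product of the e_j with j inside S, in
  -- increasing order.
  Form : ℕ → Set
  Form n = Subset n → ℚ

  infix 8 _∣ᵒ _∣ⁱ
  _∣ᵒ _∣ⁱ : ∀ {n} → Form (suc n) → Form n
  (ω ∣ᵒ) S = ω (outside ∷ S)
  (ω ∣ⁱ) S = ω (inside ∷ S)

  infixr 7 _∧_ _⌟_
  -- Left exterior multiplication and its transpose, contraction. Both split off coordinate 0, with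
  -- ω = `ω ∣ᵒ` + e₀ ∧ `ω ∣ⁱ`; the minus signs come from passing e₀.
  _∧_ _⌟_ : ∀ {n} → Vector ℚ n → Form n → Form n
  (a ∧ ω) []            = 0ℚ
  (a ∧ ω) (outside ∷ S) = ((a ∘ suc) ∧ ω ∣ᵒ) S
  (a ∧ ω) (inside  ∷ S) = a zero * ω (outside ∷ S) - ((a ∘ suc) ∧ ω ∣ⁱ) S
  (x ⌟ ω) []            = 0ℚ
  (x ⌟ ω) (outside ∷ S) = x zero * ω (inside ∷ S) + ((x ∘ suc) ⌟ ω ∣ᵒ) S
  (x ⌟ ω) (inside  ∷ S) = - ((x ∘ suc) ⌟ ω ∣ⁱ) S

  ∧-linear : ∀ {n} (a : Vector ℚ n) p q {u v w : Form n} → (∀ S → w S ≡ p * u S + q * v S) →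
             ∀ S → (a ∧ w) S ≡ p * (a ∧ u) S + q * (a ∧ v) S
  ∧-linear a p q w≡ [] = p0+q0 p q
  ∧-linear a p q w≡ (outside ∷ S) = ∧-linear (a ∘ suc) p q (λ T → w≡ (outside ∷ T)) S
  ∧-linear a p q {u} {v} w≡ (inside  ∷ S) = trans
    (cong₂ (λ r s → a zero * r - s) (w≡ (outside ∷ S)) (∧-linear (a ∘ suc) p q (λ T → w≡ (inside ∷ T)) S))
    (lemma p q (a zero) (u (outside ∷ S)) (v (outside ∷ S)) (((a ∘ suc) ∧ u ∣ⁱ) S) (((a ∘ suc) ∧ v ∣ⁱ) S))
    where
    lemma : ∀ p q a u v s t → a * (p * u + q * v) - (p * s + q * t) ≡ p * (a * u - s) + q * (a * v - t)
    lemma = solve-∀ ℚ-ring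

  ⌟-linear : ∀ {n} (x : Vector ℚ n) p q {u v w : Form n} → (∀ S → w S ≡ p * u S + q * v S) →
             ∀ S → (x ⌟ w) S ≡ p * (x ⌟ u) S + q * (x ⌟ v) S
  ⌟-linear x p q w≡ [] = p0+q0 p q
  ⌟-linear x p q {u} {v} w≡ (outside ∷ S) = trans
    (cong₂ (λ r s → x zero * r + s) (w≡ (inside ∷ S)) (⌟-linear (x ∘ suc) p q (λ T → w≡ (outside ∷ T)) S))
    (lemma p q (x zero) (u (inside ∷ S)) (v (inside ∷ S)) (((x ∘ suc) ⌟ u ∣ᵒ) S) (((x ∘ suc) ⌟ v ∣ᵒ) S))
    where
    lemma : ∀ p q a u v s t → a * (p * u + q * v) + (p * s + q * t) ≡ p * (a * u + s) + q * (a * v + t)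
    lemma = solve-∀ ℚ-ring
  ⌟-linear x p q {u} {v} w≡ (inside ∷ S) = trans
    (cong -_ (⌟-linear (x ∘ suc) p q (λ T → w≡ (inside ∷ T)) S))
    (lemma p q (((x ∘ suc) ⌟ u ∣ⁱ) S) (((x ∘ suc) ⌟ v ∣ⁱ) S))
    where
    lemma : ∀ p q s t → - (p * s + q * t) ≡ p * - s + q * - t
    lemma = solve-∀ ℚ-ring

  -- The antiderivation rule for contraction, or Clifford relation. By induction on coordinates:
  -- linearity expands the outer operation across the split at e₀, and the mixed terms on the two
  -- sides match.
  ∧-⌟-anticommute : ∀ {n} (a x : Vector ℚ n) ω S → (x ⌟ a ∧ ω) S ≡ dot a x * ω S - (a ∧ x ⌟ ω) S
  ∧-⌟-anticommute a x ω [] = lemma (ω [])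
    where
    lemma : ∀ w → 0ℚ ≡ 0ℚ * w - 0ℚ
    lemma = solve-∀ ℚ-ring
  ∧-⌟-anticommute a x ω (outside ∷ S) = begin
    x₀ * (a₀ * u - (a′ ∧ v) S) + (x′ ⌟ a′ ∧ ω ∣ᵒ) S             ≡⟨ cong (x₀ * (a₀ * u - (a′ ∧ v) S) +_) (∧-⌟-anticommute a′ x′ (ω ∣ᵒ) S) ⟩
    x₀ * (a₀ * u - (a′ ∧ v) S) + (d * u - (a′ ∧ x′ ⌟ ω ∣ᵒ) S)   ≡⟨ lemma a₀ x₀ u d ((a′ ∧ v) S) ((a′ ∧ x′ ⌟ ω ∣ᵒ) S) ⟩
    (a₀ * x₀ + d) * u - (x₀ * (a′ ∧ v) S + 1ℚ * (a′ ∧ x′ ⌟ ω ∣ᵒ) S)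
      ≡⟨ cong (λ r → (a₀ * x₀ + d) * u - r) (∧-linear a′ x₀ 1ℚ {v} {x′ ⌟ ω ∣ᵒ} (λ T → cong (x₀ * v T +_) (sym (*-identityˡ ((x′ ⌟ ω ∣ᵒ) T)))) S) ⟨
    (a₀ * x₀ + d) * u - (a′ ∧ (x ⌟ ω) ∣ᵒ) S                     ∎
    where
    a₀ = a zero
    x₀ = x zero
    a′ = a ∘ suc
    x′ = x ∘ suc
    u = ω (outside ∷ S)
    v = ω ∣ⁱ
    d = dot a′ x′
    lemma : ∀ a x u d s t → x * (a * u - s) + (d * u - t) ≡ (a * x + d) * u - (x * s + 1ℚ * t)
    lemma = solve-∀ ℚ-ring
  ∧-⌟-anticommute a x ω (inside ∷ S) = begin
    - (x′ ⌟ (a ∧ ω) ∣ⁱ) S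
      ≡⟨ cong -_ (⌟-linear x′ a₀ (- 1ℚ) {ω ∣ᵒ} {a′ ∧ ω ∣ⁱ} (λ T → pq-r a₀ (ω (outside ∷ T)) ((a′ ∧ ω ∣ⁱ) T)) S) ⟩
    - (a₀ * (x′ ⌟ ω ∣ᵒ) S + - 1ℚ * (x′ ⌟ a′ ∧ ω ∣ⁱ) S)          ≡⟨ cong (λ r → - (a₀ * (x′ ⌟ ω ∣ᵒ) S + - 1ℚ * r)) (∧-⌟-anticommute a′ x′ (ω ∣ⁱ) S) ⟩
    - (a₀ * (x′ ⌟ ω ∣ᵒ) S + - 1ℚ * (d * v - (a′ ∧ x′ ⌟ ω ∣ⁱ) S))
      ≡⟨ lemma a₀ x₀ v d ((x′ ⌟ ω ∣ᵒ) S) ((a′ ∧ x′ ⌟ ω ∣ⁱ) S) ⟩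
    (a₀ * x₀ + d) * v - (a₀ * (x₀ * v + (x′ ⌟ ω ∣ᵒ) S) - (- 1ℚ * (a′ ∧ x′ ⌟ ω ∣ⁱ) S + 0ℚ * (a′ ∧ x′ ⌟ ω ∣ⁱ) S))
      ≡⟨ cong (λ r → (a₀ * x₀ + d) * v - (a₀ * (x₀ * v + (x′ ⌟ ω ∣ᵒ) S) - r))
           (∧-linear a′ (- 1ℚ) 0ℚ {x′ ⌟ ω ∣ⁱ} {x′ ⌟ ω ∣ⁱ} (λ T → -p ((x′ ⌟ ω ∣ⁱ) T)) S) ⟨
    (a₀ * x₀ + d) * v - (a₀ * (x₀ * v + (x′ ⌟ ω ∣ᵒ) S) - (a′ ∧ (x ⌟ ω) ∣ⁱ) S)   ∎
    where
    a₀ = a zero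
    x₀ = x zero
    a′ = a ∘ suc
    x′ = x ∘ suc
    v = ω (inside ∷ S)
    d = dot a′ x′
    lemma : ∀ a x v d s t → - (a * s + - 1ℚ * (d * v - t)) ≡ (a * x + d) * v - (a * (x * v + s) - (- 1ℚ * t + 0ℚ * t))
    lemma = solve-∀ ℚ-ring

  ⟪_,_⟫ : ∀ {n} → Form n → Form n → ℚ
  ⟪_,_⟫ {zero}  ω η = ω [] * η []
  ⟪_,_⟫ {suc n} ω η = ⟪ ω ∣ᵒ , η ∣ᵒ ⟫ + ⟪ ω ∣ⁱ , η ∣ⁱ ⟫

  ⟪⟫-comm : ∀ {n} (ω η : Form n) → ⟪ ω , η ⟫ ≡ ⟪ η , ω ⟫
  ⟪⟫-comm {zero}  ω η = *-comm (ω []) (η [])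
  ⟪⟫-comm {suc n} ω η = cong₂ _+_ (⟪⟫-comm (ω ∣ᵒ) (η ∣ᵒ)) (⟪⟫-comm (ω ∣ⁱ) (η ∣ⁱ))

  ⟪⟫-linearˡ : ∀ {n} p q {u v w : Form n} (η : Form n) → (∀ S → w S ≡ p * u S + q * v S) →
              ⟪ w , η ⟫ ≡ p * ⟪ u , η ⟫ + q * ⟪ v , η ⟫
  ⟪⟫-linearˡ {zero} p q {u} {v} η w≡ = trans (cong (_* η []) (w≡ [])) (lemma p q (u []) (v []) (η []))
    where
    lemma : ∀ p q u v h → (p * u + q * v) * h ≡ p * (u * h) + q * (v * h)
    lemma = solve-∀ ℚ-ring
  ⟪⟫-linearˡ {suc n} p q {u} {v} η w≡ = trans
    (cong₂ _+_ (⟪⟫-linearˡ p q (η ∣ᵒ) (λ S → w≡ (outside ∷ S))) (⟪⟫-linearˡ p q (η ∣ⁱ) (λ S → w≡ (inside ∷ S))))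
    (lemma p q ⟪ u ∣ᵒ , η ∣ᵒ ⟫ ⟪ v ∣ᵒ , η ∣ᵒ ⟫ ⟪ u ∣ⁱ , η ∣ⁱ ⟫ ⟪ v ∣ⁱ , η ∣ⁱ ⟫)
    where
    lemma : ∀ p q a b c d → (p * a + q * b) + (p * c + q * d) ≡ p * (a + c) + q * (b + d)
    lemma = solve-∀ ℚ-ring

  -- `x ⌟_` carries the coefficient at S ∪ {j} to S with the sign with which `x ∧_` carries it back.
  -- Linearity is at hand in the left slot only, hence the swaps by `⟪⟫-comm`.
  ⌟-∧-adjoint : ∀ {n} (x : Vector ℚ n) ω η → ⟪ x ⌟ ω , η ⟫ ≡ ⟪ ω , x ∧ η ⟫
  ⌟-∧-adjoint {zero}  x ω η = trans (*-zeroˡ (η [])) (sym (*-zeroʳ (ω [])))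
  ⌟-∧-adjoint {suc n} x ω η = begin
    ⟪ (x ⌟ ω) ∣ᵒ , ηᵒ ⟫ + ⟪ (x ⌟ ω) ∣ⁱ , ηⁱ ⟫
      ≡⟨ cong₂ _+_
           (⟪⟫-linearˡ x₀ 1ℚ {ωⁱ} {x′ ⌟ ωᵒ} ηᵒ (λ S → cong (x₀ * ωⁱ S +_) (sym (*-identityˡ ((x′ ⌟ ωᵒ) S)))))
           (⟪⟫-linearˡ (- 1ℚ) 0ℚ {x′ ⌟ ωⁱ} {x′ ⌟ ωⁱ} ηⁱ (λ S → -p ((x′ ⌟ ωⁱ) S))) ⟩
    (x₀ * ⟪ ωⁱ , ηᵒ ⟫ + 1ℚ * ⟪ x′ ⌟ ωᵒ , ηᵒ ⟫) + (- 1ℚ * ⟪ x′ ⌟ ωⁱ , ηⁱ ⟫ + 0ℚ * ⟪ x′ ⌟ ωⁱ , ηⁱ ⟫)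
      ≡⟨ cong₂ (λ r s → (x₀ * ⟪ ωⁱ , ηᵒ ⟫ + 1ℚ * r) + (- 1ℚ * s + 0ℚ * s)) (⌟-∧-adjoint x′ ωᵒ ηᵒ) (⌟-∧-adjoint x′ ωⁱ ηⁱ) ⟩
    (x₀ * ⟪ ωⁱ , ηᵒ ⟫ + 1ℚ * ⟪ ωᵒ , x′ ∧ ηᵒ ⟫) + (- 1ℚ * ⟪ ωⁱ , x′ ∧ ηⁱ ⟫ + 0ℚ * ⟪ ωⁱ , x′ ∧ ηⁱ ⟫)
      ≡⟨ lemma x₀ ⟪ ωⁱ , ηᵒ ⟫ ⟪ ωᵒ , x′ ∧ ηᵒ ⟫ ⟪ ωⁱ , x′ ∧ ηⁱ ⟫ ⟩
    ⟪ ωᵒ , x′ ∧ ηᵒ ⟫ + (x₀ * ⟪ ωⁱ , ηᵒ ⟫ + - 1ℚ * ⟪ ωⁱ , x′ ∧ ηⁱ ⟫)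
      ≡⟨ cong (λ r → ⟪ ωᵒ , x′ ∧ ηᵒ ⟫ + r) (cong₂ (λ r s → x₀ * r + - 1ℚ * s) (⟪⟫-comm ωⁱ ηᵒ) (⟪⟫-comm ωⁱ (x′ ∧ ηⁱ))) ⟩
    ⟪ ωᵒ , x′ ∧ ηᵒ ⟫ + (x₀ * ⟪ ηᵒ , ωⁱ ⟫ + - 1ℚ * ⟪ x′ ∧ ηⁱ , ωⁱ ⟫)
      ≡⟨ cong (⟪ ωᵒ , x′ ∧ ηᵒ ⟫ +_)
           (⟪⟫-linearˡ x₀ (- 1ℚ) {ηᵒ} {x′ ∧ ηⁱ} ωⁱ (λ S → pq-r x₀ (ηᵒ S) ((x′ ∧ ηⁱ) S))) ⟨
    ⟪ ωᵒ , x′ ∧ ηᵒ ⟫ + ⟪ (x ∧ η) ∣ⁱ , ωⁱ ⟫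
      ≡⟨ cong (⟪ ωᵒ , x′ ∧ ηᵒ ⟫ +_) (⟪⟫-comm ((x ∧ η) ∣ⁱ) ωⁱ) ⟩
    ⟪ ωᵒ , x′ ∧ ηᵒ ⟫ + ⟪ ωⁱ , (x ∧ η) ∣ⁱ ⟫   ∎
    where
    x₀ = x zero
    x′ = x ∘ suc
    ωᵒ = ω ∣ᵒ
    ωⁱ = ω ∣ⁱ
    ηᵒ = η ∣ᵒ
    ηⁱ = η ∣ⁱ
    lemma : ∀ x a b c → (x * a + 1ℚ * b) + (- 1ℚ * c + 0ℚ * c) ≡ b + (x * a + - 1ℚ * c)
    lemma = solve-∀ ℚ-ring

  -- Order and norm inequalities

  0≤*0≤ : ∀ {p q} → 0ℚ ≤ p → 0ℚ ≤ q → 0ℚ ≤ p * q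
  0≤*0≤ {p} {q} 0≤p 0≤q =
    nonNegative⁻¹ _ {{nonNeg*nonNeg⇒nonNeg p {{nonNegative 0≤p}} q {{nonNegative 0≤q}}}}

  0<*0< : ∀ {p q} → 0ℚ < p → 0ℚ < q → 0ℚ < p * q
  0<*0< {p} {q} 0<p 0<q = positive⁻¹ _ {{pos*pos⇒pos p {{positive 0<p}} q {{positive 0<q}}}}

  0<^ : ∀ {p} k → 0ℚ < p → 0ℚ < p ^ℚ k
  0<^ zero    0<p = positive⁻¹ 1ℚ
  0<^ (suc k) 0<p = 0<*0< 0<p (0<^ k 0<p)

  *-monoˡ : ∀ {r p q} → 0ℚ ≤ r → p ≤ q → r * p ≤ r * q
  *-monoˡ {r} 0≤r = *-monoˡ-≤-nonNeg r {{nonNegative 0≤r}}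

  *-mono : ∀ {p q r s} → 0ℚ ≤ p → 0ℚ ≤ s → p ≤ q → r ≤ s → p * r ≤ q * s
  *-mono {p} {q} {r} {s} 0≤p 0≤s p≤q r≤s =
    ≤-trans (*-monoˡ 0≤p r≤s) (*-monoʳ-≤-nonNeg s {{nonNegative 0≤s}} p≤q)

  ∣p∣²≡p² : ∀ p → ∣ p ∣ * ∣ p ∣ ≡ p * p
  ∣p∣²≡p² p with ∣p∣≡p∨∣p∣≡-p p
  ... | inj₁ eq = cong₂ _*_ eq eq
  ... | inj₂ eq = trans (cong₂ _*_ eq eq) (lemma p)
    where
    lemma : ∀ p → - p * - p ≡ p * p
    lemma = solve-∀ ℚ-ring

  0≤p² : ∀ p → 0ℚ ≤ p * p
  0≤p² p = subst (0ℚ ≤_) (∣p∣²≡p² p) (0≤*0≤ (0≤∣p∣ p) (0≤∣p∣ p))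

  ∣p∣≤q⇒p²≤q² : ∀ {p q} → ∣ p ∣ ≤ q → p * p ≤ q * q
  ∣p∣≤q⇒p²≤q² {p} {q} ∣p∣≤q =
    subst (_≤ q * q) (∣p∣²≡p² p) (*-mono (0≤∣p∣ p) (≤-trans (0≤∣p∣ p) ∣p∣≤q) ∣p∣≤q ∣p∣≤q)

  p²≤q²⇒∣p∣≤q : ∀ {p q} → 0ℚ ≤ q → p * p ≤ q * q → ∣ p ∣ ≤ q
  p²≤q²⇒∣p∣≤q {p} {q} 0≤q p²≤q² = ≮⇒≥ λ q<∣p∣ → <-irrefl refl $
    <-≤-trans
      (≤-<-trans (*-monoˡ 0≤q (<⇒≤ q<∣p∣))
        (*-monoˡ-<-pos ∣ p ∣ {{positive (≤-<-trans 0≤q q<∣p∣)}} q<∣p∣))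
      (subst (_≤ q * q) (sym (∣p∣²≡p² p)) p²≤q²)

  ⟪0,0⟫ : ∀ n → ⟪ (λ (_ : Subset n) → 0ℚ) , (λ _ → 0ℚ) ⟫ ≡ 0ℚ
  ⟪0,0⟫ zero    = refl
  ⟪0,0⟫ (suc n) = cong₂ _+_ (⟪0,0⟫ n) (⟪0,0⟫ n)

  ⟪⟫-cong : ∀ {n} {ω η : Form n} → (∀ S → ω S ≡ η S) → ⟪ ω , ω ⟫ ≡ ⟪ η , η ⟫
  ⟪⟫-cong {zero}  ω≡η = cong₂ _*_ (ω≡η []) (ω≡η [])
  ⟪⟫-cong {suc n} ω≡η = cong₂ _+_ (⟪⟫-cong (λ S → ω≡η (outside ∷ S))) (⟪⟫-cong (λ S → ω≡η (inside ∷ S)))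

  0≤dot : ∀ {n} (x : Vector ℚ n) → 0ℚ ≤ dot x x
  0≤dot {zero}  x = ≤-refl
  0≤dot {suc n} x = +-mono-≤ (0≤p² (x zero)) (0≤dot (x ∘ suc))

  0≤⟪ω,ω⟫ : ∀ {n} (ω : Form n) → 0ℚ ≤ ⟪ ω , ω ⟫
  0≤⟪ω,ω⟫ {zero}  ω = 0≤p² (ω [])
  0≤⟪ω,ω⟫ {suc n} ω = +-mono-≤ (0≤⟪ω,ω⟫ (ω ∣ᵒ)) (0≤⟪ω,ω⟫ (ω ∣ⁱ))

  -- Adjointness moves one operator of each norm across the pairing; the two composites then add up
  -- to multiplication by `dot x x`, by the anticommutation rule with a = x.
  ⌟-pythagoras : ∀ {n} (x : Vector ℚ n) η →
                 ⟪ x ⌟ η , x ⌟ η ⟫ + ⟪ x ∧ η , x ∧ η ⟫ ≡ dot x x * ⟪ η , η ⟫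
  ⌟-pythagoras x η = begin
    ⟪ x ⌟ η , x ⌟ η ⟫ + ⟪ x ∧ η , x ∧ η ⟫
      ≡⟨ cong₂ _+_ (trans (⌟-∧-adjoint x η (x ⌟ η)) (⟪⟫-comm η (x ∧ x ⌟ η))) (sym (⌟-∧-adjoint x (x ∧ η) η)) ⟩
    ⟪ x ∧ x ⌟ η , η ⟫ + ⟪ x ⌟ x ∧ η , η ⟫
      ≡⟨ cong (⟪ x ∧ x ⌟ η , η ⟫ +_)
           (⟪⟫-linearˡ (dot x x) (- 1ℚ) {η} {x ∧ x ⌟ η} η λ S →
             trans (∧-⌟-anticommute x x η S) (pq-r (dot x x) (η S) ((x ∧ x ⌟ η) S))) ⟩
    ⟪ x ∧ x ⌟ η , η ⟫ + (dot x x * ⟪ η , η ⟫ + - 1ℚ * ⟪ x ∧ x ⌟ η , η ⟫)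
      ≡⟨ lemma ⟪ x ∧ x ⌟ η , η ⟫ (dot x x * ⟪ η , η ⟫) ⟩
    dot x x * ⟪ η , η ⟫   ∎
    where
    lemma : ∀ p q → p + (q + - 1ℚ * p) ≡ q
    lemma = solve-∀ ℚ-ring

  ⌟-zero : ∀ {n} (x : Vector ℚ n) {ω : Form n} → (∀ S → ω S ≡ 0ℚ) → ∀ S → (x ⌟ ω) S ≡ 0ℚ
  ⌟-zero x {ω} ω≡0 S = trans (⌟-linear x 0ℚ 0ℚ {ω} {ω} (λ T → trans (ω≡0 T) (0p+0p (ω T))) S) (sym (0p+0p ((x ⌟ ω) S)))

  ∧-zero : ∀ {n} (a : Vector ℚ n) {ω : Form n} → (∀ S → ω S ≡ 0ℚ) → ∀ S → (a ∧ ω) S ≡ 0ℚ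
  ∧-zero a {ω} ω≡0 S = trans (∧-linear a 0ℚ 0ℚ {ω} {ω} (λ T → trans (ω≡0 T) (0p+0p (ω T))) S) (sym (0p+0p ((a ∧ ω) S)))

  -- Contraction with x maps a ∧ ω to (a·x) ω, and has operator norm at most ∣x∣.
  ∧-norm-lower : ∀ {n} (a x : Vector ℚ n) ω → (∀ S → (x ⌟ ω) S ≡ 0ℚ) →
                 (dot a x * dot a x) * ⟪ ω , ω ⟫ ≤ dot x x * ⟪ a ∧ ω , a ∧ ω ⟫
  ∧-norm-lower a x ω x⌟ω≡0 = subst₂ _≤_ norm (⌟-pythagoras x (a ∧ ω))
    (subst (_≤ ⟪ c , c ⟫ + ⟪ w , w ⟫) (+-identityʳ ⟪ c , c ⟫) (+-monoʳ-≤ ⟪ c , c ⟫ (0≤⟪ω,ω⟫ w)))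
    where
    c = x ⌟ a ∧ ω
    w = x ∧ a ∧ ω
    d = dot a x
    lemma₁ : ∀ r w → r * w - 0ℚ ≡ r * w + 0ℚ * w
    lemma₁ = solve-∀ ℚ-ring
    lemma₂ : ∀ d r → d * (d * r + 0ℚ * r) + 0ℚ * (d * r + 0ℚ * r) ≡ (d * d) * r
    lemma₂ = solve-∀ ℚ-ring
    c≡ : ∀ S → c S ≡ d * ω S + 0ℚ * ω S
    c≡ S = trans (∧-⌟-anticommute a x ω S)
      (trans (cong (λ r → d * ω S - r) (∧-zero a x⌟ω≡0 S)) (lemma₁ d (ω S)))
    norm : ⟪ c , c ⟫ ≡ (d * d) * ⟪ ω , ω ⟫
    norm = begin
      ⟪ c , c ⟫                           ≡⟨ ⟪⟫-linearˡ d 0ℚ {ω} {ω} c c≡ ⟩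
      d * ⟪ ω , c ⟫ + 0ℚ * ⟪ ω , c ⟫      ≡⟨ cong (λ r → d * r + 0ℚ * r) (trans (⟪⟫-comm ω c) (⟪⟫-linearˡ d 0ℚ {ω} {ω} ω c≡)) ⟩
      d * (d * ⟪ ω , ω ⟫ + 0ℚ * ⟪ ω , ω ⟫) + 0ℚ * (d * ⟪ ω , ω ⟫ + 0ℚ * ⟪ ω , ω ⟫)   ≡⟨ lemma₂ d ⟪ ω , ω ⟫ ⟩
      (d * d) * ⟪ ω , ω ⟫                 ∎

  -- Minors as coefficients of wedge products

  -- The form of degree k whose coefficient at a k-element set, given by its
  -- increasing enumeration s, is f s.
  form : ∀ {k n} → (Vector (Fin n) k → ℚ) → Form n
  form         f (outside ∷ S) = form (λ s → f (suc ∘ s)) S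
  form {zero}  f []            = f λ ()
  form {suc k} f []            = 0ℚ
  form {zero}  f (inside  ∷ S) = 0ℚ
  form {suc k} f (inside  ∷ S) = form {k} (λ s → f (zero Vector.∷ (suc ∘ s))) S

  form-linear : ∀ {k n} p q {f g h : Vector (Fin n) k → ℚ} → (∀ s → h s ≡ p * f s + q * g s) →
                ∀ S → form h S ≡ p * form f S + q * form g S
  form-linear {zero}  p q h≡ []            = h≡ λ ()
  form-linear {suc k} p q h≡ []            = p0+q0 p q
  form-linear         p q h≡ (outside ∷ S) = form-linear p q (λ s → h≡ (suc ∘ s)) S
  form-linear {zero}  p q h≡ (inside  ∷ S) = p0+q0 p q
  form-linear {suc k} p q h≡ (inside  ∷ S) = form-linear {k} p q (λ s → h≡ (zero Vector.∷ (suc ∘ s))) S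

  -- The first-row expansion of `det`, with `f` in the role of the minor of the remaining rows, so
  -- that the recursion for `detℚ` is an instance by definition.
  laplace : ∀ {k n} → Vector ℚ n → (Vector (Fin n) k → ℚ) → Vector (Fin n) (suc k) → ℚ
  laplace a f s = sumℚ λ j → ((- 1ℚ) ^ℚ toℕ j) * (a (s j) * f (λ i → s (punchIn j i)))

  -- The term `j = zero` picks column 0; in the others column 0 stays in the minor and the sign
  -- shifts by one. Deleting a later column gives that selection only pointwise, hence `f-cong`.
  laplace-∷ : ∀ {k n} (a : Vector ℚ (suc n)) (f : Vector (Fin (suc n)) (suc k) → ℚ) →
              (∀ {s t} → s ≗ t → f s ≡ f t) → ∀ s →
              laplace a f (zero Vector.∷ (suc ∘ s)) ≡
              a zero * f (suc ∘ s) + - 1ℚ * laplace (a ∘ suc) (λ t → f (zero Vector.∷ (suc ∘ t))) s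
  laplace-∷ a f f-cong s = cong₂ _+_ (*-identityˡ (a zero * f (suc ∘ s))) (trans
    (sum-cong-≗ λ j → trans
      (*-assoc (- 1ℚ) ((- 1ℚ) ^ℚ toℕ j) _)
      (cong (λ r → - 1ℚ * (((- 1ℚ) ^ℚ toℕ j) * (a (suc (s j)) * r))) (f-cong (punch j))))
    (sym (*-distribˡ-sum (- 1ℚ) (λ j → ((- 1ℚ) ^ℚ toℕ j) * (a (suc (s j)) * f (zero Vector.∷ (λ i → suc (s (punchIn j i)))))))))
    where
    punch : ∀ j i → (zero Vector.∷ (suc ∘ s)) (punchIn (suc j) i) ≡ (zero Vector.∷ (λ l → suc (s (punchIn j l)))) i
    punch j zero    = refl
    punch j (suc i) = refl

  -- Wedging with a row is Laplace expansion on coefficients: both split by whether column 0 is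
  -- selected, and for k > 0 `laplace-∷` is the selected case.
  ∧-form : ∀ {k n} (a : Vector ℚ n) (f : Vector (Fin n) k → ℚ) → (∀ {s t} → s ≗ t → f s ≡ f t) →
           ∀ S → (a ∧ form f) S ≡ form (laplace a f) S
  ∧-form a f f-cong [] = refl
  ∧-form a f f-cong (outside ∷ S) =
    ∧-form (a ∘ suc) (λ s → f (suc ∘ s)) (λ s≗t → f-cong (cong suc ∘ s≗t)) S
  ∧-form {zero}  a f f-cong (inside ∷ S) = begin
    a zero * form f′ S - ((a ∘ suc) ∧ (λ _ → 0ℚ)) S   ≡⟨ cong (λ r → a zero * form f′ S - r) (∧-zero (a ∘ suc) (λ _ → refl) S) ⟩
    a zero * form f′ S - 0ℚ                            ≡⟨ lemma₁ (a zero) (form f′ S) ⟩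
    a zero * form f′ S + 0ℚ * form f′ S                ≡⟨ form-linear (a zero) 0ℚ {f′} {f′} (λ s → trans
      (cong (λ r → 1ℚ * (a zero * r) + 0ℚ) (f-cong {_} {suc ∘ s} λ ())) (lemma₂ (a zero) (f (suc ∘ s)))) S ⟨
    form (λ s → laplace a f (zero Vector.∷ (suc ∘ s))) S   ∎
    where
    f′ : Vector (Fin _) zero → ℚ
    f′ s = f (suc ∘ s)
    lemma₁ : ∀ p r → p * r - 0ℚ ≡ p * r + 0ℚ * r
    lemma₁ = solve-∀ ℚ-ring
    lemma₂ : ∀ p r → 1ℚ * (p * r) + 0ℚ ≡ p * r + 0ℚ * r
    lemma₂ = solve-∀ ℚ-ring
  ∧-form {suc k} a f f-cong (inside ∷ S) = begin
    a zero * form f′ S - ((a ∘ suc) ∧ form f″) S   ≡⟨ cong (λ r → a zero * form f′ S - r)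
      (∧-form (a ∘ suc) f″ (λ s≗t → f-cong λ { zero → refl ; (suc i) → cong suc (s≗t i) }) S) ⟩
    a zero * form f′ S - form (laplace (a ∘ suc) f″) S            ≡⟨ pq-r (a zero) (form f′ S) _ ⟩
    a zero * form f′ S + - 1ℚ * form (laplace (a ∘ suc) f″) S     ≡⟨ form-linear (a zero) (- 1ℚ) (laplace-∷ a f f-cong) S ⟨
    form (λ s → laplace a f (zero Vector.∷ (suc ∘ s))) S          ∎
    where
    f′ : Vector (Fin _) (suc k) → ℚ
    f′ s = f (suc ∘ s)
    f″ : Vector (Fin _) k → ℚ
    f″ s = f (zero Vector.∷ (suc ∘ s))

  Increasing : ∀ {k n} → Vector (Fin n) k → Set
  Increasing s = ∀ {i j} → i Fin.< j → s i Fin.< s j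

  suc-increasing : ∀ {k n} {s : Vector (Fin n) k} → Increasing s → Increasing (suc ∘ s)
  suc-increasing s↑ i<j = s≤s (s↑ i<j)

  ∷-increasing : ∀ {k n} {s : Vector (Fin n) k} → Increasing s → Increasing (zero Vector.∷ (suc ∘ s))
  ∷-increasing s↑ {zero}  {suc j} _         = s≤s z≤n
  ∷-increasing s↑ {suc i} {suc j} (s≤s i<j) = s≤s (s↑ i<j)

  2ℚ : ℚ
  2ℚ = 1ℚ + 1ℚ

  -- The number of coefficients is bounded by 2ⁿ.
  form-norm-upper : ∀ {k n} (f : Vector (Fin n) k → ℚ) {M} → 0ℚ ≤ M →
                    (∀ s → Increasing s → f s * f s ≤ M) → ⟪ form f , form f ⟫ ≤ 2ℚ ^ℚ n * M
  form-norm-upper {zero}  {zero}  f {M} 0≤M f²≤M = subst (_ ≤_) (sym (*-identityˡ M)) (f²≤M _ λ {i} → contradiction i λ ())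
  form-norm-upper {suc k} {zero}  f {M} 0≤M f²≤M = subst (0ℚ ≤_) (sym (*-identityˡ M)) 0≤M
  form-norm-upper {k} {suc n} f {M} 0≤M f²≤M = subst (_ ≤_) (double (2ℚ ^ℚ n) M) (+-mono-≤ {_} {2ℚ ^ℚ n * M}
    (form-norm-upper {k} (λ s → f (suc ∘ s)) 0≤M (λ s s↑ → f²≤M (suc ∘ s) (suc-increasing s↑)))
    (inside-part k f f²≤M))
    where
    double : ∀ p m → p * m + p * m ≡ (2ℚ * p) * m
    double = solve-∀ ℚ-ring
    0≤2ⁿM : 0ℚ ≤ 2ℚ ^ℚ n * M
    0≤2ⁿM = 0≤*0≤ (<⇒≤ (0<^ n (positive⁻¹ 2ℚ))) 0≤M
    inside-part : ∀ k (f : Vector (Fin (suc n)) k → ℚ) → (∀ s → Increasing s → f s * f s ≤ M) →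
                  ⟪ form f ∣ⁱ , form f ∣ⁱ ⟫ ≤ 2ℚ ^ℚ n * M
    inside-part zero    f f²≤M = subst (_≤ 2ℚ ^ℚ n * M) (sym (⟪0,0⟫ n)) 0≤2ⁿM
    inside-part (suc k) f f²≤M =
      form-norm-upper {k} (λ s → f (zero Vector.∷ (suc ∘ s))) 0≤M (λ s s↑ → f²≤M _ (∷-increasing s↑))

  ⋀ : ∀ {k n} → Matrix ℚ k n → Form n
  ⋀ {zero}  A = form {zero} λ _ → 1ℚ
  ⋀ {suc k} A = A zero ∧ ⋀ (A ∘ suc)

  det-cong : ∀ {n} {A B : Matrix ℚ n n} → (∀ i j → A i j ≡ B i j) → detℚ A ≡ detℚ B
  det-cong {zero}  A≡B = refl
  det-cong {suc n} A≡B = sum-cong-≗ λ j → cong₂ (λ p q → ((- 1ℚ) ^ℚ toℕ j) * (p * q))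
    (A≡B zero j) (det-cong λ i l → A≡B (suc i) (punchIn j l))

  ∧-cong : ∀ {n} (a : Vector ℚ n) {ω η : Form n} → (∀ S → ω S ≡ η S) → ∀ S → (a ∧ ω) S ≡ (a ∧ η) S
  ∧-cong a {ω} {η} ω≡η S = trans (∧-linear a 1ℚ 0ℚ {η} {η} (λ T → trans (ω≡η T) (lemma (η T))) S) (sym (lemma _))
    where
    lemma : ∀ p → p ≡ 1ℚ * p + 0ℚ * p
    lemma = solve-∀ ℚ-ring

  -- These are the Plücker coordinates of the rows: each wedge with a row is one Laplace expansion.
  ⋀-minors : ∀ {k n} (A : Matrix ℚ k n) S → ⋀ A S ≡ form (λ s → detℚ (λ i j → A i (s j))) S
  ⋀-minors {zero}  A S = refl
  ⋀-minors {suc k} A S = trans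
    (∧-cong (A zero) (⋀-minors (A ∘ suc)) S)
    (∧-form (A zero) (λ s → detℚ (λ i j → A (suc i) (s j))) (λ s≗t → det-cong λ i j → cong (A (suc i)) (s≗t j)) S)

  -- By the antiderivation rule contraction meets the rows one at a time, each with the vanishing
  -- factor `dot (A i) x`. The empty wedge is a scalar, which contraction kills.
  ⌟-⋀ : ∀ {k n} (A : Matrix ℚ k n) x → (∀ i → dot (A i) x ≡ 0ℚ) → ∀ S → (x ⌟ ⋀ A) S ≡ 0ℚ
  ⌟-⋀ {zero}  A x A·x≡0 S = ⌟-scalar x S
    where
    ⌟-scalar : ∀ {n} (x : Vector ℚ n) S → (x ⌟ form {zero} λ _ → 1ℚ) S ≡ 0ℚ
    ⌟-scalar x []            = refl
    ⌟-scalar x (outside ∷ S) = trans (cong₂ _+_ (*-zeroʳ (x zero)) (⌟-scalar (x ∘ suc) S)) refl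
    ⌟-scalar x (inside  ∷ S) = cong -_ (⌟-zero (x ∘ suc) (λ _ → refl) S)
  ⌟-⋀ {suc k} A x A·x≡0 S = begin
    (x ⌟ A zero ∧ ⋀ (A ∘ suc)) S        ≡⟨ ∧-⌟-anticommute (A zero) x (⋀ (A ∘ suc)) S ⟩
    dot (A zero) x * w - (A zero ∧ x ⌟ ⋀ (A ∘ suc)) S
      ≡⟨ cong₂ (λ p q → p * w - q) (A·x≡0 zero) (∧-zero (A zero) (⌟-⋀ (A ∘ suc) x (A·x≡0 ∘ suc)) S) ⟩
    0ℚ * w - 0ℚ                          ≡⟨ lemma w ⟩
    0ℚ                                   ∎
    where
    w = ⋀ (A ∘ suc) S
    lemma : ∀ w → 0ℚ * w - 0ℚ ≡ 0ℚ
    lemma = solve-∀ ℚ-ring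

  -- Greedy selection of rows

  16ℚ : ℚ
  16ℚ = 2ℚ * (2ℚ * (2ℚ * 2ℚ))

  -- One pass of Gram–Schmidt, from the last row: a row is kept if its squared
  -- distance ∣a ∧ ω∣² / ∣ω∣² to the span of the rows kept so far, whose wedge
  -- product is ω, exceeds L.
  select-rows : ∀ {m n} (A : Matrix ℚ m n) {L} → 0ℚ < L →
                ∃[ k ] ∃[ s ] Increasing {k} s ×
                L ^ℚ k ≤ ⟪ ⋀ (A ∘ s) , ⋀ (A ∘ s) ⟫ ×
                (∀ x → (∀ i → dot (A (s i)) x ≡ 0ℚ) → ∀ i → dot (A i) x * dot (A i) x ≤ L * dot x x)
  select-rows {zero} {n} A 0<L = zero , (λ ()) , (λ {i} → contradiction i λ ()) , ≤-reflexive (sym (norm n)) , λ _ _ ()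
    where
    norm : ∀ n → ⟪ form {zero} {n} (λ _ → 1ℚ) , form {zero} (λ _ → 1ℚ) ⟫ ≡ 1ℚ
    norm zero    = refl
    norm (suc n) = trans (cong₂ _+_ (norm n) (⟪0,0⟫ n)) refl
  select-rows {suc m} {n} A {L} 0<L with select-rows (A ∘ suc) 0<L
  ... | k , s , s↑ , Lᵏ≤ , near with ⟪ A zero ∧ ⋀ (A ∘ suc ∘ s) , A zero ∧ ⋀ (A ∘ suc ∘ s) ⟫ ≤? L * ⟪ ⋀ (A ∘ suc ∘ s) , ⋀ (A ∘ suc ∘ s) ⟫
  ... | yes ≤L = k , suc ∘ s , suc-increasing s↑ , Lᵏ≤ , near′
    where
    ω = ⋀ (A ∘ suc ∘ s)
    0<ω : 0ℚ < ⟪ ω , ω ⟫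
    0<ω = <-≤-trans (0<^ k 0<L) Lᵏ≤
    rearrange : ∀ l d w → d * (l * w) ≡ (l * d) * w
    rearrange = solve-∀ ℚ-ring
    near′ : ∀ x → (∀ i → dot (A (suc (s i))) x ≡ 0ℚ) → ∀ i → dot (A i) x * dot (A i) x ≤ L * dot x x
    -- (a·x)²∣ω∣² ≤ ∣x∣²∣a ∧ ω∣² ≤ L∣x∣²∣ω∣², where ∣ω∣² ≥ Lᵏ is positive and cancels.
    near′ x ⊥ zero = *-cancelʳ-≤-pos ⟪ ω , ω ⟫ {{positive 0<ω}} $
      ≤-trans (∧-norm-lower (A zero) x ω (⌟-⋀ (A ∘ suc ∘ s) x ⊥)) $
      subst (dot x x * _ ≤_) (rearrange L (dot x x) ⟪ ω , ω ⟫) (*-monoˡ (0≤dot x) ≤L)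
    near′ x ⊥ (suc i) = near x ⊥ i
  ... | no ≰L = suc k , zero Vector.∷ (suc ∘ s) , ∷-increasing s↑
      , ≤-trans (*-monoˡ (<⇒≤ 0<L) Lᵏ≤) (<⇒≤ (≰⇒> ≰L)) , near′
    where
    near′ : ∀ x → (∀ i → dot (A ((zero Vector.∷ (suc ∘ s)) i)) x ≡ 0ℚ) → ∀ i → dot (A i) x * dot (A i) x ≤ L * dot x x
    near′ x ⊥ zero    = subst (λ r → r * r ≤ L * dot x x) (sym (⊥ zero)) (0≤*0≤ (<⇒≤ 0<L) (0≤dot x))
    near′ x ⊥ (suc i) = near x (⊥ ∘ suc) i

  -- The inequality `detlb A ≤ D` with the roots cleared; it passes to submatrices on increasing
  -- rows and columns.
  MinorsBounded : ∀ {m n} → Matrix ℚ m n → ℚ → Set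
  MinorsBounded A D = ∀ {k} s t → Increasing {k} s → Increasing t → ∣ detℚ (submatrix A s t) ∣ ≤ D ^ℚ k

  ^-cancel-≤ : ∀ m n → 2ℚ ^ℚ m ≤ 2ℚ ^ℚ n → m ℕ.≤ n
  ^-cancel-≤ zero    n       _  = z≤n
  ^-cancel-≤ (suc m) zero    2ᵐ≤1 = contradiction (<-≤-trans (positive⁻¹ (2ℚ - 1ℚ)) (+-monoˡ-≤ (- 1ℚ) (≤-trans (2≤ m) 2ᵐ≤1))) (<-irrefl refl)
    where
    2≤ : ∀ m → 2ℚ ≤ 2ℚ ^ℚ suc m
    2≤ zero    = ≤-refl
    2≤ (suc m) = ≤-trans (2≤ m) (subst (_≤ 2ℚ * 2ℚ ^ℚ suc m) (*-identityˡ (2ℚ ^ℚ suc m))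
      (*-monoʳ-≤-nonNeg (2ℚ ^ℚ suc m) {{nonNegative (<⇒≤ (0<^ (suc m) (positive⁻¹ 2ℚ)))}} (+-monoʳ-≤ 1ℚ (<⇒≤ (positive⁻¹ 1ℚ)))))
  ^-cancel-≤ (suc m) (suc n) 2ᵐ≤2ⁿ = s≤s (^-cancel-≤ m n (*-cancelˡ-≤-pos 2ℚ 2ᵐ≤2ⁿ))

  -- ∣ω∣² lies between (16 D²)ᵏ = 2⁴ᵏ D²ᵏ and 2ⁿ D²ᵏ. Cancelling D²ᵏ compares the exponents of 2;
  -- the choice 16 = 2⁴ yields k ≤ n/4.
  few-rows : ∀ {k m n} {A : Matrix ℚ m n} {D} → 0ℚ < D → MinorsBounded A D → (s : Vector (Fin m) k) → Increasing s →
             (16ℚ * (D * D)) ^ℚ k ≤ ⟪ ⋀ (A ∘ s) , ⋀ (A ∘ s) ⟫ → k ℕ.* 4 ℕ.≤ n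
  few-rows {k} {n = n} {A} {D} 0<D bounded s s↑ Lᵏ≤ = ^-cancel-≤ (k ℕ.* 4) n $
    *-cancelʳ-≤-pos (D ^ℚ k * D ^ℚ k) {{positive (0<*0< 0<Dᵏ 0<Dᵏ)}} $
    ≤-trans (subst₂ _≤_ (powers k) norm Lᵏ≤)
     (form-norm-upper minor (0≤p² (D ^ℚ k)) (λ t t↑ → ∣p∣≤q⇒p²≤q² (bounded s t s↑ t↑)))
    where
    0<Dᵏ : 0ℚ < D ^ℚ k
    0<Dᵏ = 0<^ k 0<D
    minor : Vector (Fin n) k → ℚ
    minor t = detℚ (submatrix A s t)
    norm : ⟪ ⋀ (A ∘ s) , ⋀ (A ∘ s) ⟫ ≡ ⟪ form minor , form minor ⟫
    norm = ⟪⟫-cong (⋀-minors (A ∘ s))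
    lemma : ∀ t d p q → (t * (t * (t * t)) * (d * d)) * (p * (q * q)) ≡ (t * (t * (t * (t * p)))) * ((d * q) * (d * q))
    lemma = solve-∀ ℚ-ring
    powers : ∀ k → (16ℚ * (D * D)) ^ℚ k ≡ 2ℚ ^ℚ (k ℕ.* 4) * (D ^ℚ k * D ^ℚ k)
    powers zero    = refl
    powers (suc k) = trans (cong ((16ℚ * (D * D)) *_) (powers k)) (lemma 2ℚ D (2ℚ ^ℚ (k ℕ.* 4)) (D ^ℚ k))

  -- Kernel vectors of wide matrices

  dot-congʳ : ∀ {n} (a : Vector ℚ n) {x y} → x ≗ y → dot a x ≡ dot a y
  dot-congʳ a x≗y = sum-cong-≗ λ j → cong (a j *_) (x≗y j)

  dot-zero : ∀ {n} {a : Vector ℚ n} → (∀ j → a j ≡ 0ℚ) → ∀ x → dot a x ≡ 0ℚ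
  dot-zero {zero}  a≡0 x = refl
  dot-zero {suc n} a≡0 x = cong₂ _+_ (trans (cong (_* x zero) (a≡0 zero)) (*-zeroˡ (x zero))) (dot-zero (a≡0 ∘ suc) (x ∘ suc))

  dot-insertAt : ∀ {n} (a : Vector ℚ (suc n)) x p c →
                 dot a (Vector.insertAt x p c) ≡ a p * c + dot (a ∘ punchIn p) x
  dot-insertAt a x p c = trans (sum-remove {i = p} (λ j → a j * Vector.insertAt x p c j)) $
    cong₂ _+_ (cong (a p *_) (insertAt-lookup x p c))
      (dot-congʳ (a ∘ punchIn p) (insertAt-punchIn x p c))

  -- Gaussian elimination: a zero first row is dropped; otherwise its pivot `p` clears a column, and
  -- a kernel vector of the smaller system is lifted back.
  kernel : ∀ {k n} → k ℕ.< n → (C : Matrix ℚ k n) →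
           ∃[ v ] (∃[ j ] v j ≢ 0ℚ) × (∀ i → dot (C i) v ≡ 0ℚ)
  kernel {zero}  {suc n} _         C = (λ _ → 1ℚ) , (zero , λ ()) , λ ()
  kernel {suc k} {suc n} (s≤s k<n) C with Finₚ.any? (λ p → ¬? (C zero p ≟ 0ℚ))
  ... | no C₀≡0 =
    let v , v≢0 , Cv≡0 = kernel (ℕₚ.<-trans k<n (ℕₚ.n<1+n n)) (C ∘ suc)
    in v , v≢0 , λ where
      zero    → dot-zero (λ j → decidable-stable (C zero j ≟ 0ℚ) λ C₀ⱼ≢0 → C₀≡0 (j , C₀ⱼ≢0)) v
      (suc i) → Cv≡0 i
  ... | yes (p , c≢0) =
    let v , (j , vⱼ≢0) , C′v≡0 = kernel k<n C′
        d = dot (C zero ∘ punchIn p) v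
        -- Scaling by the pivot `c` avoids dividing by it: the first row gives c·(-d) + c·d = 0.
        w = Vector.insertAt (λ l → c * v l) p (- d)
        Cw : ∀ i → dot (C i) w ≡ C i p * - d + (c * dot (C i ∘ punchIn p) v + 0ℚ * dot (C i ∘ punchIn p) v)
        Cw i = trans (dot-insertAt (C i) (λ l → c * v l) p (- d))
          (cong (C i p * - d +_) (dot-linearʳ (C i ∘ punchIn p) c 0ℚ {v} {v} λ l → pad c (v l)))
    in w
     , (punchIn p j , λ wⱼ≡0 → vⱼ≢0 (cancel (trans (sym (insertAt-punchIn (λ l → c * v l) p (- d) j)) wⱼ≡0)))
     , λ where
       zero    → trans (Cw zero) (lemma₀ c d)
       (suc i) → trans (Cw (suc i)) $ trans (sym (lemma₁ (C (suc i) p) d c (dot (C (suc i) ∘ punchIn p) v))) $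
         trans (sym (dot-linearˡ v c (- C (suc i) p) {C (suc i) ∘ punchIn p} {C zero ∘ punchIn p} λ _ → refl)) (C′v≡0 i)
    where
    c = C zero p
    C′ : Matrix ℚ k n
    C′ i l = c * C (suc i) (punchIn p l) + - C (suc i) p * C zero (punchIn p l)
    pad : ∀ c v → c * v ≡ c * v + 0ℚ * v
    pad = solve-∀ ℚ-ring
    lemma₀ : ∀ c d → c * - d + (c * d + 0ℚ * d) ≡ 0ℚ
    lemma₀ = solve-∀ ℚ-ring
    lemma₁ : ∀ q d c r → c * r + - q * d ≡ q * - d + (c * r + 0ℚ * r)
    lemma₁ = solve-∀ ℚ-ring
    cancel : ∀ {q} → c * q ≡ 0ℚ → q ≡ 0ℚ
    cancel {q} cq≡0 = begin
      q                  ≡⟨ *-identityˡ q ⟨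
      1ℚ * q             ≡⟨ cong (_* q) (*-inverseˡ c) ⟨
      (1/ c) * c * q     ≡⟨ *-assoc (1/ c) c q ⟩
      (1/ c) * (c * q)   ≡⟨ cong ((1/ c) *_) cq≡0 ⟩
      (1/ c) * 0ℚ        ≡⟨ *-zeroʳ (1/ c) ⟩
      0ℚ                 ∎
      where instance _ = ≢-nonZero c≢0
    dot-linearˡ : ∀ {n} (x : Vector ℚ n) p q {a b z : Vector ℚ n} → (∀ j → z j ≡ p * a j + q * b j) →
                  dot z x ≡ p * dot a x + q * dot b x
    dot-linearˡ x p q {a} {b} {z} z≡ = trans (dot-comm z x) $ trans (dot-linearʳ x p q z≡) $
      cong₂ (λ r s → p * r + q * s) (dot-comm x a) (dot-comm x b)

  -- Moving a point of the cube to its boundary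

  sgn : Sign → ℚ
  sgn Sign.+ = 1ℚ
  sgn Sign.- = - 1ℚ

  Bounded₁ : ℚ → Set
  Bounded₁ p = - 1ℚ ≤ p × p ≤ 1ℚ

  sgn-bounded₁ : ∀ s → Bounded₁ (sgn s)
  sgn-bounded₁ Sign.+ = toWitness {a? = - 1ℚ ≤? 1ℚ} _ , ≤-refl
  sgn-bounded₁ Sign.- = ≤-refl , toWitness {a? = - 1ℚ ≤? 1ℚ} _

  -- `p + t * v` is monotone in `t`, so one endpoint bounds it above and the other below; the sign
  -- of `v` decides which.
  segment-bounded₁ : ∀ {p v t T} → 0ℚ ≤ t → t ≤ T → Bounded₁ p → Bounded₁ (p + T * v) → Bounded₁ (p + t * v)
  segment-bounded₁ {p} {v} {t} {T} 0≤t t≤T (-1≤p , p≤1) (-1≤q , q≤1) with ≤-total 0ℚ v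
  ... | inj₁ 0≤v = ≤-trans -1≤p (subst (_≤ p + t * v) (+-identityʳ p) (+-monoʳ-≤ p (0≤*0≤ 0≤t 0≤v)))
                 , ≤-trans (+-monoʳ-≤ p (*-monoʳ-≤-nonNeg v {{nonNegative 0≤v}} t≤T)) q≤1
  ... | inj₂ v≤0 = ≤-trans -1≤q (+-monoʳ-≤ p (*-monoʳ-≤-nonPos v {{nonPositive v≤0}} t≤T))
                 , ≤-trans (subst (p + t * v ≤_) (trans (cong (p +_) (*-zeroʳ t)) (+-identityʳ p)) (+-monoʳ-≤ p (*-monoˡ 0≤t v≤0))) p≤1

  -- The time (±1 - p)/v at which a moving coordinate meets the end of the interval it heads for.
  reach : ∀ {p v} → Bounded₁ p → v ≢ 0ℚ → ∃[ t ] 0ℚ ≤ t × ∃[ s ] p + t * v ≡ sgn s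
  reach {p} {v} (-1≤p , p≤1) v≢0 with <-cmp 0ℚ v
  ... | tri< 0<v _ _ = (1ℚ - p) * 1/ v , 0≤*0≤ 0≤1-p (<⇒≤ (positive⁻¹ _ {{1/pos⇒pos v}})) , Sign.+
      , trans (cong (p +_) (trans (*-assoc (1ℚ - p) (1/ v) v) (cong ((1ℚ - p) *_) (*-inverseˡ v)))) (lemma p)
    where
    instance
      v-positive : Positive v
      v-positive = positive 0<v
      v-nonZero : NonZero v
      v-nonZero = pos⇒nonZero v
    0≤1-p : 0ℚ ≤ 1ℚ - p
    0≤1-p = subst (_≤ 1ℚ - p) (+-inverseʳ p) (+-monoˡ-≤ (- p) p≤1)
    lemma : ∀ p → p + (1ℚ - p) * 1ℚ ≡ 1ℚ
    lemma = solve-∀ ℚ-ring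
  ... | tri≈ _ 0≡v _ = contradiction (sym 0≡v) v≢0
  ... | tri> _ _ v<0 = (- 1ℚ - p) * 1/ v
      , subst (_≤ (- 1ℚ - p) * 1/ v) (*-zeroˡ (1/ v)) (*-monoʳ-≤-nonPos (1/ v) {{neg⇒nonPos (1/ v) {{1/neg⇒neg v}}}} -1-p≤0)
      , Sign.-
      , trans (cong (p +_) (trans (*-assoc (- 1ℚ - p) (1/ v) v) (cong ((- 1ℚ - p) *_) (*-inverseˡ v)))) (lemma p)
    where
    instance
      v-negative : Negative v
      v-negative = negative v<0
      v-nonZero : NonZero v
      v-nonZero = neg⇒nonZero v
    lemma : ∀ p → p + (- 1ℚ - p) * 1ℚ ≡ - 1ℚ
    lemma = solve-∀ ℚ-ring
    -1-p≤0 : - 1ℚ - p ≤ 0ℚ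
    -1-p≤0 = subst (- 1ℚ - p ≤_) (+-inverseʳ p) (+-monoˡ-≤ (- p) -1≤p)

  stay : ∀ {p v} t → v ≡ 0ℚ → Bounded₁ p → Bounded₁ (p + t * v)
  stay {p} t refl = subst Bounded₁ (sym (trans (cong (p +_) (*-zeroʳ t)) (+-identityʳ p)))

  -- The induction keeps the earlier of two times from `reach`; the coordinate that would arrive
  -- later is then still inside its interval, by convexity.
  hit-boundary : ∀ {n} (x v : Vector ℚ n) → (∀ j → Bounded₁ (x j)) →
                 (∀ j → v j ≡ 0ℚ) ⊎
                 (∃[ t ] 0ℚ ≤ t × (∀ j → Bounded₁ (x j + t * v j)) × ∃[ j ] ∃[ s ] x j + t * v j ≡ sgn s)
  hit-boundary {zero}  x v x∈ = inj₁ λ ()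
  hit-boundary {suc n} x v x∈ with v zero ≟ 0ℚ | hit-boundary (x ∘ suc) (v ∘ suc) (x∈ ∘ suc)
  ... | yes v₀≡0 | inj₁ v≡0 = inj₁ λ { zero → v₀≡0 ; (suc j) → v≡0 j }
  ... | yes v₀≡0 | inj₂ (t , 0≤t , y∈ , j , s , yⱼ≡s) =
    inj₂ (t , 0≤t , (λ { zero → stay t v₀≡0 (x∈ zero) ; (suc j) → y∈ j }) , suc j , s , yⱼ≡s)
  ... | no v₀≢0  | inj₁ v≡0 =
    let t , 0≤t , s , y₀≡s = reach (x∈ zero) v₀≢0
    in inj₂ (t , 0≤t , (λ { zero → subst Bounded₁ (sym y₀≡s) (sgn-bounded₁ s) ; (suc j) → stay t (v≡0 j) (x∈ (suc j)) }) , zero , s , y₀≡s)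
  ... | no v₀≢0  | inj₂ (T , 0≤T , y∈ , j , s , yⱼ≡s) with reach (x∈ zero) v₀≢0
  ...   | t , 0≤t , s₀ , y₀≡s₀ with ≤-total t T
  ...     | inj₁ t≤T = inj₂ (t , 0≤t
            , (λ { zero → subst Bounded₁ (sym y₀≡s₀) (sgn-bounded₁ s₀) ; (suc j) → segment-bounded₁ 0≤t t≤T (x∈ (suc j)) (y∈ j) })
            , zero , s₀ , y₀≡s₀)
  ...     | inj₂ T≤t = inj₂ (T , 0≤T
            , (λ { zero → segment-bounded₁ 0≤T T≤t (x∈ zero) (subst Bounded₁ (sym y₀≡s₀) (sgn-bounded₁ s₀)) ; (suc j) → y∈ j })
            , suc j , s , yⱼ≡s)

  -- While more than k coordinates are free, C has a kernel vector supported on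
  -- them; moving along it turns one of them into a sign and preserves C x.  F
  -- lists the coordinates that stay free: rounding them to z completes y to σ.
  round-up-to : ∀ {k n} (C : Matrix ℚ k n) x → (∀ j → Bounded₁ (x j)) →
    ∃[ y ] (∀ j → Bounded₁ (y j)) × (∀ i → dot (C i) y ≡ dot (C i) x) ×
    ∃[ l ] l ℕ.≤ k × ∃[ F ] Increasing {l} F ×
    ∀ (z : Vector Sign l) → ∃[ σ ] ∀ a →
      dot a (sgn ∘ σ) - dot a y ≡ dot (a ∘ F) (sgn ∘ z) - dot (a ∘ F) (y ∘ F)
  round-up-to {k} {n} C x x∈ with n ℕₚ.≤? k
  ... | yes n≤k = x , x∈ , (λ _ → refl) , n , n≤k , id , (λ i<j → i<j) , λ z → z , λ _ → refl
  round-up-to {k} {zero}  C x x∈ | no n≰k = contradiction z≤n n≰k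
  round-up-to {k} {suc n} C x x∈ | no n≰k with kernel (ℕₚ.≰⇒> n≰k) C
  ... | v , (j₀ , vⱼ≢0) , Cv≡0 with hit-boundary x v x∈
  ...   | inj₁ v≡0 = contradiction (v≡0 j₀) vⱼ≢0
  -- Coordinate `j` is frozen at the sign it reached; the recursion runs on the other columns.
  ...   | inj₂ (t , _ , x′∈ , j , s , x′ⱼ≡s)
    with round-up-to (λ i → C i ∘ punchIn j) (λ l → x (punchIn j l) + t * v (punchIn j l)) (x′∈ ∘ punchIn j)
  ...     | y , y∈ , Cy≡ , l , l≤k , F , F↑ , fill =
    y′ , y′∈ , Cy′≡ , l , l≤k , punchIn j ∘ F , punchIn-increasing j ∘ F↑ , fill′
    where
    y′ : Vector ℚ (suc n)
    y′ = Vector.insertAt y j (sgn s)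
    y′∈ : ∀ i → Bounded₁ (y′ i)
    y′∈ i with j Finₚ.≟ i
    ... | yes refl = subst Bounded₁ (sym (insertAt-lookup y j (sgn s))) (sgn-bounded₁ s)
    ... | no  j≢i  = subst (Bounded₁ ∘ y′) (Finₚ.punchIn-punchOut j≢i)
      (subst Bounded₁ (sym (insertAt-punchIn y j (sgn s) (punchOut j≢i))) (y∈ (punchOut j≢i)))
    lemma₁ : ∀ p t → p + t * 0ℚ ≡ p
    lemma₁ = solve-∀ ℚ-ring
    lemma₂ : ∀ p t q → p + t * q ≡ 1ℚ * p + t * q
    lemma₂ = solve-∀ ℚ-ring
    lemma₃ : ∀ p q r → (p + q) - (p + r) ≡ q - r
    lemma₃ = solve-∀ ℚ-ring
    Cy′≡ : ∀ i → dot (C i) y′ ≡ dot (C i) x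
    Cy′≡ i = begin
      dot (C i) y′                                             ≡⟨ dot-insertAt (C i) y j (sgn s) ⟩
      C i j * sgn s + dot (C i ∘ punchIn j) y                  ≡⟨ cong₂ (λ p q → C i j * p + q) (sym x′ⱼ≡s) (Cy≡ i) ⟩
      C i j * x′ j + dot (C i ∘ punchIn j) (x′ ∘ punchIn j)    ≡⟨ sum-remove {i = j} (λ l → C i l * x′ l) ⟨
      dot (C i) x′                                             ≡⟨ dot-linearʳ (C i) 1ℚ t {x} {v} (λ l → lemma₂ (x l) t (v l)) ⟩
      1ℚ * dot (C i) x + t * dot (C i) v                       ≡⟨ cong₂ (λ p q → p + t * q) (*-identityˡ (dot (C i) x)) (Cv≡0 i) ⟩
      dot (C i) x + t * 0ℚ                                     ≡⟨ lemma₁ (dot (C i) x) t ⟩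
      dot (C i) x                                              ∎
      where
      x′ : Vector ℚ (suc n)
      x′ l = x l + t * v l
    fill′ : ∀ z → ∃[ σ ] ∀ a → dot a (sgn ∘ σ) - dot a y′ ≡
                               dot (a ∘ punchIn j ∘ F) (sgn ∘ z) - dot (a ∘ punchIn j ∘ F) (y′ ∘ punchIn j ∘ F)
    fill′ z = let σ , σ≡ = fill z in Vector.insertAt σ j s , λ a → begin
      dot a (sgn ∘ Vector.insertAt σ j s) - dot a y′
        ≡⟨ cong₂ _-_ (trans (dot-congʳ a (sgn-insertAt σ j)) (dot-insertAt a (sgn ∘ σ) j (sgn s))) (dot-insertAt a y j (sgn s)) ⟩
      (a j * sgn s + dot (a ∘ punchIn j) (sgn ∘ σ)) - (a j * sgn s + dot (a ∘ punchIn j) y)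
        ≡⟨ lemma₃ (a j * sgn s) _ _ ⟩
      dot (a ∘ punchIn j) (sgn ∘ σ) - dot (a ∘ punchIn j) y
        ≡⟨ σ≡ (a ∘ punchIn j) ⟩
      dot (a ∘ punchIn j ∘ F) (sgn ∘ z) - dot (a ∘ punchIn j ∘ F) (y ∘ F)
        ≡⟨ cong (λ r → dot (a ∘ punchIn j ∘ F) (sgn ∘ z) - r)
             (dot-congʳ (a ∘ punchIn j ∘ F) λ i → insertAt-punchIn y j (sgn s) (F i)) ⟨
      dot (a ∘ punchIn j ∘ F) (sgn ∘ z) - dot (a ∘ punchIn j ∘ F) (y′ ∘ punchIn j ∘ F)   ∎
      where
      sgn-insertAt : ∀ {n} (σ : Vector Sign n) j → sgn ∘ Vector.insertAt σ j s ≗ Vector.insertAt (sgn ∘ σ) j (sgn s)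
      sgn-insertAt {zero}  σ zero    zero    = refl
      sgn-insertAt {suc n} σ zero    zero    = refl
      sgn-insertAt {suc n} σ zero    (suc i) = refl
      sgn-insertAt {suc n} σ (suc j) zero    = refl
      sgn-insertAt {suc n} σ (suc j) (suc i) = sgn-insertAt (σ ∘ suc) j i
    punchIn-increasing : ∀ {n} (i : Fin (suc n)) {j k : Fin n} → j Fin.< k → punchIn i j Fin.< punchIn i k
    punchIn-increasing zero    j<k = s≤s j<k
    punchIn-increasing (suc i) {zero}  {suc k} _         = s≤s z≤n
    punchIn-increasing (suc i) {suc j} {suc k} (s≤s j<k) = s≤s (punchIn-increasing i j<k)

-- Repeated partial rounding

module _ where
  open import Data.Rational.Base
  open import Data.Rational.Properties
  open ≤-Reasoning

  infix 9 _·1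
  _·1 : ℕ → ℚ
  n ·1 = n ×ℚ 1ℚ

  0≤·1 : ∀ n → 0ℚ ≤ n ·1
  0≤·1 zero    = ≤-refl
  0≤·1 (suc n) = +-mono-≤ (<⇒≤ (positive⁻¹ 1ℚ)) (0≤·1 n)

  ·1-mono : ∀ {m n} → m ℕ.≤ n → m ·1 ≤ n ·1
  ·1-mono {n = n} z≤n = 0≤·1 n
  ·1-mono (s≤s m≤n)   = +-monoʳ-≤ 1ℚ (·1-mono m≤n)

  4ℚ : ℚ
  4ℚ = 2ℚ * 2ℚ

  ·1-*4 : ∀ l → (l ℕ.* 4) ·1 ≡ 4ℚ * l ·1
  ·1-*4 zero    = refl
  ·1-*4 (suc l) = trans (cong (λ r → 1ℚ + (1ℚ + (1ℚ + (1ℚ + r)))) (·1-*4 l)) (lemma (l ·1))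
    where
    lemma : ∀ r → 1ℚ + (1ℚ + (1ℚ + (1ℚ + (1ℚ + 1ℚ) * (1ℚ + 1ℚ) * r))) ≡ (1ℚ + 1ℚ) * (1ℚ + 1ℚ) * (1ℚ + r)
    lemma = solve-∀ ℚ-ring

  cube-diameter : ∀ {n} (x y : Vector ℚ n) → (∀ j → Bounded₁ (x j)) → (∀ j → Bounded₁ (y j)) →
                  dot (λ j → x j - y j) (λ j → x j - y j) ≤ 4ℚ * n ·1
  cube-diameter {zero}  x y x∈ y∈ = ≤-refl
  cube-diameter {suc n} x y x∈ y∈ = subst (dot (λ j → x j - y j) (λ j → x j - y j) ≤_) (sym (lemma 4ℚ (n ·1)))
    (+-mono-≤ (∣p∣≤q⇒p²≤q² {q = 2ℚ} (∣x-y∣≤2 (x∈ zero) (y∈ zero))) (cube-diameter (x ∘ suc) (y ∘ suc) (x∈ ∘ suc) (y∈ ∘ suc)))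
    where
    lemma : ∀ c r → c * (1ℚ + r) ≡ c + c * r
    lemma = solve-∀ ℚ-ring
    ∣p∣≤1 : ∀ {p} → Bounded₁ p → ∣ p ∣ ≤ 1ℚ
    ∣p∣≤1 {p} (-1≤p , p≤1) with ∣p∣≡p∨∣p∣≡-p p
    ... | inj₁ eq = subst (_≤ 1ℚ) (sym eq) p≤1
    ... | inj₂ eq = subst (_≤ 1ℚ) (sym eq) (neg-antimono-≤ -1≤p)
    ∣x-y∣≤2 : ∀ {p q} → Bounded₁ p → Bounded₁ q → ∣ p - q ∣ ≤ 2ℚ
    ∣x-y∣≤2 {p} {q} p∈ q∈ = ≤-trans (∣p-q∣≤∣p∣+∣q∣ p q) (+-mono-≤ (∣p∣≤1 p∈) (∣p∣≤1 q∈))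

  -- `r` stands for √n. One partial rounding costs 8 r D and leaves at most n/4 free columns, so the
  -- recursion runs with r/2 and the bound closes as 8 + 16/2 = 16.
  low-discrepancy-rounding : ∀ {m n} (A : Matrix ℚ m n) {D r} → 0ℚ < D → 0ℚ ≤ r → n ·1 ≤ r * r → MinorsBounded A D →
    ∀ x → (∀ j → Bounded₁ (x j)) → ∃[ σ ] ∀ i → ∣ dot (A i) (sgn ∘ σ) - dot (A i) x ∣ ≤ 16ℚ * (r * D)
  low-discrepancy-rounding {n = n} A = go n ℕₚ.≤-refl A
    where
    -- `b` is fuel: the next column count `l` is below `n`, but not structurally smaller.
    go : ∀ {m n} b → n ℕ.≤ b → (A : Matrix ℚ m n) → ∀ {D r} → 0ℚ < D → 0ℚ ≤ r → n ·1 ≤ r * r → MinorsBounded A D →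
      ∀ x → (∀ j → Bounded₁ (x j)) → ∃[ σ ] ∀ i → ∣ dot (A i) (sgn ∘ σ) - dot (A i) x ∣ ≤ 16ℚ * (r * D)
    go {n = zero} b _ A 0<D 0≤r _ _ x _ = (λ ()) , λ i → 0≤*0≤ (<⇒≤ (positive⁻¹ 16ℚ)) (0≤*0≤ 0≤r (<⇒≤ 0<D))
    go {n = n@(suc _)} (suc b) n≤b A {D} {r} 0<D 0≤r n≤r² bounded x x∈
      with select-rows A (0<*0< (positive⁻¹ 16ℚ) (0<*0< 0<D 0<D))
    ... | k , s , s↑ , Lᵏ≤ , near with round-up-to (A ∘ s) x x∈
    ...   | y , y∈ , Ay≡Ax , l , l≤k , F , F↑ , fill =
      -- 4 l ≤ n ≤ r² gives l ≤ (r/2)², and the free columns inherit the minor bound.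
      let z , z≤ = go b l≤b (λ i → A i ∘ F) {r = ½ * r} 0<D (0≤*0≤ (<⇒≤ (positive⁻¹ ½)) 0≤r) l≤r²/4
                     (λ s′ t s′↑ t↑ → bounded s′ (F ∘ t) s′↑ (F↑ ∘ t↑)) (y ∘ F) (y∈ ∘ F)
          σ , σ≡ = fill z
      in σ , λ i → begin
        ∣ dot (A i) (sgn ∘ σ) - dot (A i) x ∣
          ≡⟨ cong ∣_∣ (telescope (dot (A i) (sgn ∘ σ)) (dot (A i) y) (dot (A i) x)) ⟩
        ∣ (dot (A i) (sgn ∘ σ) - dot (A i) y) + (dot (A i) y - dot (A i) x) ∣
          ≤⟨ ∣p+q∣≤∣p∣+∣q∣ (dot (A i) (sgn ∘ σ) - dot (A i) y) (dot (A i) y - dot (A i) x) ⟩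
        ∣ dot (A i) (sgn ∘ σ) - dot (A i) y ∣ + ∣ dot (A i) y - dot (A i) x ∣
          ≤⟨ +-mono-≤ (subst (λ p → ∣ p ∣ ≤ 16ℚ * (½ * r * D)) (sym (σ≡ (A i))) (z≤ i)) (moved i) ⟩
        16ℚ * (½ * r * D) + 8ℚ * (r * D)
          ≡⟨ halves r D ⟩
        16ℚ * (r * D)   ∎
      where
      8ℚ : ℚ
      8ℚ = 2ℚ * 4ℚ
      k*4≤n : k ℕ.* 4 ℕ.≤ n
      k*4≤n = few-rows {A = A} 0<D bounded s s↑ Lᵏ≤
      l*4≤n : l ℕ.* 4 ℕ.≤ n
      l*4≤n = ℕₚ.≤-trans (ℕₚ.*-monoˡ-≤ 4 l≤k) k*4≤n
      l≤b : l ℕ.≤ b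
      l≤b = quarter (ℕₚ.≤-trans l*4≤n n≤b)
        where
        quarter : ∀ {l b} → l ℕ.* 4 ℕ.≤ suc b → l ℕ.≤ b
        quarter {zero}  _           = z≤n
        quarter {suc l} (s≤s l*4≤b) = ℕₚ.≤-trans (s≤s (ℕₚ.≤-trans (ℕₚ.m≤m*n l 4) (ℕₚ.m≤n+m (l ℕ.* 4) 2))) l*4≤b
      telescope : ∀ p q r → p - r ≡ (p - q) + (q - r)
      telescope = solve-∀ ℚ-ring
      halves : ∀ r d → 16ℚ * (½ * r * d) + 8ℚ * (r * d) ≡ 16ℚ * (r * d)
      halves = solve-∀ ℚ-ring
      l≤r²/4 : l ·1 ≤ ½ * r * (½ * r)
      l≤r²/4 = *-cancelˡ-≤-pos 4ℚ (subst₂ _≤_ (·1-*4 l) (lemma₃ r) (≤-trans (·1-mono l*4≤n) n≤r²))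
        where
        lemma₃ : ∀ r → r * r ≡ 4ℚ * (½ * r * (½ * r))
        lemma₃ = solve-∀ ℚ-ring
      moved : ∀ i → ∣ dot (A i) y - dot (A i) x ∣ ≤ 8ℚ * (r * D)
      -- y - x is orthogonal to the kept rows, so `near` applies; as ∣y - x∣² ≤ 4n ≤ 4r², the square
      -- is at most 16 D² · 4 r² = (8 r D)².
      moved i = p²≤q²⇒∣p∣≤q (0≤*0≤ (<⇒≤ (positive⁻¹ 8ℚ)) (0≤*0≤ 0≤r (<⇒≤ 0<D))) (begin
        (dot (A i) y - dot (A i) x) * (dot (A i) y - dot (A i) x)   ≡⟨ cong₂ _*_ (dot-sub (A i)) (dot-sub (A i)) ⟨
        dot (A i) d * dot (A i) d         ≤⟨ near d (λ j → trans (dot-sub (A (s j))) (trans (cong (_- dot (A (s j)) x) (Ay≡Ax j)) (+-inverseʳ (dot (A (s j)) x)))) i ⟩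
        16ℚ * (D * D) * dot d d           ≤⟨ *-monoˡ 0≤L (≤-trans (cube-diameter y x y∈ x∈) (*-monoˡ (<⇒≤ (positive⁻¹ 4ℚ)) n≤r²)) ⟩
        16ℚ * (D * D) * (4ℚ * (r * r))    ≡⟨ lemma₄ r D ⟩
        8ℚ * (r * D) * (8ℚ * (r * D))     ∎)
        where
        d : Vector ℚ n
        d j = y j - x j
        0≤L : 0ℚ ≤ 16ℚ * (D * D)
        0≤L = 0≤*0≤ (<⇒≤ (positive⁻¹ 16ℚ)) (0≤p² D)
        subtract : ∀ p q → p - q ≡ 1ℚ * p + - 1ℚ * q
        subtract = solve-∀ ℚ-ring
        dot-sub : ∀ a → dot a d ≡ dot a y - dot a x
        dot-sub a = trans (dot-linearʳ a 1ℚ (- 1ℚ) {y} {x} (λ j → subtract (y j) (x j))) (sym (subtract (dot a y) (dot a x)))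
        lemma₄ : ∀ r d → 16ℚ * (d * d) * (4ℚ * (r * r)) ≡ 8ℚ * (r * d) * (8ℚ * (r * d))
        lemma₄ = solve-∀ ℚ-ring

open import Algebra.Bundles.Raw using (RawRing)
open import Data.Integer.Base as ℤ using (+_)
import Data.Integer.Properties as ℤₚ
open import Data.Integer.Tactic.RingSolver using () renaming (solve-∀ to ℤ-solve-∀)
open import Data.List.Base as List using (List; []; _∷_; upTo)
open import Data.List.Membership.Propositional using (_∈_)
open import Data.List.Membership.Propositional.Properties
  using (∈-map⁺; ∈-map⁻; ∈-++⁺ˡ; ∈-++⁺ʳ; ∈-++⁻; ∈-upTo⁺)
open import Data.List.NonEmpty as List⁺ using (List⁺; _∷_)
open import Data.List.Relation.Unary.Any using (here; there)
open import Data.Nat.Base using (NonZero)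
open import Data.Rational.Base as ℚ using (ℚ; mkℚ; 0ℚ; 1ℚ)
import Data.Rational.Unnormalised.Base as ℚᵘ
import Data.Rational.Unnormalised.Properties as ℚᵘₚ
open import Defs
open import Level using (0ℓ)

-- Completeness of the lists of selections and signings

positive-predecessors : ∀ {k n} {s : Vector (Fin (suc n)) k} → Increasing s → (∀ i → zero ≢ s i) →
                        ∃[ t ] Increasing t × s ≗ suc ∘ t
positive-predecessors {s = s} s↑ 0≢s = (λ i → punchOut (0≢s i))
  , (λ {i} {j} i<j → ℕ.s≤s⁻¹ (subst₂ Fin._<_ (s≡ i) (s≡ j) (s↑ i<j)))
  , s≡
  where
  s≡ : ∀ i → s i ≡ suc (punchOut (0≢s i))
  s≡ i = sym (Finₚ.punchIn-punchOut (0≢s i))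

-- Selections are functions, so the list is searched for a pointwise equal one. Whether the first
-- entry is 0 decides which half contains it.
increasing⇒∈selections : ∀ {k n} (s : Vector (Fin n) k) → Increasing s → ∃[ t ] t ∈ selections k n × s ≗ t
increasing⇒∈selections {zero}          s s↑ = _ , here refl , λ ()
increasing⇒∈selections {suc k} {zero}  s s↑ = contradiction (s zero) λ ()
increasing⇒∈selections {suc k} {suc n} s s↑ with s zero in s₀≡
... | zero =
  let p , p↑ , s≡ = positive-predecessors {s = s ∘ suc} (s↑ ∘ s≤s) (λ i 0≡ → tail≢ i (sym 0≡))
      t , t∈ , p≡ = increasing⇒∈selections p p↑
  in zero Vector.∷ (suc ∘ t) , ∈-++⁺ˡ (∈-map⁺ _ t∈)
   , λ { zero → s₀≡ ; (suc i) → trans (s≡ i) (cong suc (p≡ i)) }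
  where
  tail≢ : ∀ i → s (suc i) ≢ zero
  tail≢ i eq = contradiction (subst (s zero Fin.<_) eq (s↑ {zero} {suc i} (s≤s z≤n))) λ ()
... | suc q =
  let p , p↑ , s≡ = positive-predecessors {s = s} s↑ λ where
        zero    0≡ → contradiction (trans 0≡ s₀≡) λ ()
        (suc i) 0≡ → contradiction (subst (s zero Fin.<_) (sym 0≡) (s↑ {zero} {suc i} (s≤s z≤n))) λ ()
      t , t∈ , p≡ = increasing⇒∈selections p p↑
  in suc ∘ t , ∈-++⁺ʳ _ (∈-map⁺ (suc ∘_) t∈) , λ i → trans (s≡ i) (cong suc (p≡ i))

∈selections⇒increasing : ∀ {k n} {s : Vector (Fin n) k} → s ∈ selections k n → Increasing s
∈selections⇒increasing {zero}          (here refl) {()}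
∈selections⇒increasing {suc k} {suc n} s∈ with ∈-++⁻ (List.map (λ s → zero Vector.∷ (suc ∘ s)) (selections k n)) s∈
... | inj₁ s∈ˡ with t , t∈ , refl ← ∈-map⁻ (λ s → zero Vector.∷ (suc ∘ s)) s∈ˡ = ∷-increasing (∈selections⇒increasing t∈)
... | inj₂ s∈ʳ with t , t∈ , refl ← ∈-map⁻ (suc ∘_) s∈ʳ = suc-increasing (∈selections⇒increasing t∈)

∈selections⇒≤ : ∀ {k n} {s : Vector (Fin n) k} → s ∈ selections k n → k ℕ.≤ n
∈selections⇒≤ {zero}          _  = z≤n
∈selections⇒≤ {suc k} {suc n} s∈ with ∈-++⁻ (List.map (λ s → zero Vector.∷ (suc ∘ s)) (selections k n)) s∈
... | inj₁ s∈ˡ with t , t∈ , _ ← ∈-map⁻ (λ s → zero Vector.∷ (suc ∘ s)) s∈ˡ = s≤s (∈selections⇒≤ t∈)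
... | inj₂ s∈ʳ with t , t∈ , _ ← ∈-map⁻ (suc ∘_) s∈ʳ = ℕₚ.m≤n⇒m≤1+n (∈selections⇒≤ t∈)

∈signings : ∀ {n} (σ : Vector Sign n) → ∃[ τ ] τ ∈ List⁺.toList (signings n) × σ ≗ τ
∈signings {zero}  σ = _ , here refl , λ ()
∈signings {suc n} σ with σ zero in σ₀≡ | ∈signings (σ ∘ suc)
... | Sign.+ | τ , τ∈ , σ≡τ = Sign.+ Vector.∷ τ , ∈-++⁺ˡ (∈-map⁺ (Sign.+ Vector.∷_) τ∈)
                            , λ { zero → σ₀≡ ; (suc i) → σ≡τ i }
... | Sign.- | τ , τ∈ , σ≡τ = Sign.- Vector.∷ τ , ∈-++⁺ʳ (List⁺.toList (List⁺.map (Sign.+ Vector.∷_) (signings n))) (∈-map⁺ (Sign.- Vector.∷_) τ∈)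
                            , λ { zero → σ₀≡ ; (suc i) → σ≡τ i }

-- Real quantities evaluated at one index

infixl 9 _at_
_at_ : ∀ {m n} → Matrix ℝ m n → ℕ → Matrix ℚ m n
(A at N) i j = seq (A i j) N

module _ (R : RawRing 0ℓ 0ℓ) (h : RawRing.Carrier R → ℚ)
         (h-+ : ∀ x y → h (RawRing._+_ R x y) ≡ h x ℚ.+ h y)
         (h-* : ∀ x y → h (RawRing._*_ R x y) ≡ h x ℚ.* h y)
         (h-neg : ∀ x → h (RawRing.-_ R x) ≡ ℚ.- h x)
         (h-0 : h (RawRing.0# R) ≡ 0ℚ) (h-1 : h (RawRing.1# R) ≡ 1ℚ) where

  private
    module R where
      open RawRing R public
      open import Algebra.Definitions.RawSemiring rawSemiring public using (_^_; sum)
      open Determinant R public using (det)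

  sum-homo : ∀ {n} (x : Vector R.Carrier n) → h (R.sum x) ≡ sumℚ (h ∘ x)
  sum-homo {zero}  x = h-0
  sum-homo {suc n} x = trans (h-+ (x zero) _) (cong (h (x zero) ℚ.+_) (sum-homo (x ∘ suc)))

  ^-homo : ∀ x k → h (x R.^ k) ≡ h x ^ℚ k
  ^-homo x zero    = h-1
  ^-homo x (suc k) = trans (h-* x _) (cong (h x ℚ.*_) (^-homo x k))

  -- `det` is a polynomial in the entries, so it commutes with maps preserving the ring operations;
  -- taking the N-th term of a Cauchy sequence preserves them by definition.
  det-homo : ∀ {n} (A : Matrix R.Carrier n n) → h (R.det A) ≡ detℚ (λ i j → h (A i j))
  det-homo {zero}  A = h-1
  det-homo {suc n} A = trans (sum-homo term) (sum-cong-≗ λ j → trans (h-* _ _) (cong₂ ℚ._*_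
    (trans (^-homo (R.- R.1#) (toℕ j)) (cong (_^ℚ toℕ j) (trans (h-neg R.1#) (cong ℚ.-_ h-1))))
    (trans (h-* _ _) (cong (h (A zero j) ℚ.*_) (det-homo λ a b → A (suc a) (punchIn j b))))))
    where
    term : Vector R.Carrier (suc n)
    term j = ((R.- R.1#) R.^ toℕ j) R.* (A zero j R.* R.det (λ a b → A (suc a) (punchIn j b)))

seq-sum : ∀ {n} (x : Vector ℝ n) N → seq (sum x) N ≡ sumℚ (λ i → seq (x i) N)
seq-sum x N = sum-homo ℝ-rawRing (λ x → seq x N) (λ _ _ → refl) (λ _ _ → refl) (λ _ → refl) refl refl x

seq-det : ∀ {n} (A : Matrix ℝ n n) N → seq (det A) N ≡ detℚ (A at N)
seq-det A N = det-homo ℝ-rawRing (λ x → seq x N) (λ _ _ → refl) (λ _ _ → refl) (λ _ → refl) refl refl A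

max-upper : ∀ {a} {X : Set a} {xs : List X} (f : X → ℝ) N {x} → x ∈ xs → seq (f x) N ℚ.≤ seq (max xs f) N
max-upper {xs = x ∷ xs} f N (here refl) = ℚₚ.p≤p⊔q (seq (f x) N) (seq (max xs f) N)
max-upper {xs = x ∷ xs} f N (there y∈)  = ℚₚ.≤-trans (max-upper f N y∈) (ℚₚ.p≤q⊔p (seq (f x) N) (seq (max xs f) N))

max-least : ∀ {a} {X : Set a} (xs : List X) (f : X → ℝ) N {B} → 0ℚ ℚ.≤ B →
            (∀ {x} → x ∈ xs → seq (f x) N ℚ.≤ B) → seq (max xs f) N ℚ.≤ B
max-least []       f N 0≤B f≤B = 0≤B
max-least (x ∷ xs) f N 0≤B f≤B = ℚₚ.⊔-lub (f≤B (here refl)) (max-least xs f N 0≤B (f≤B ∘ there))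

max-nonneg : ∀ {a} {X : Set a} (xs : List X) (f : X → ℝ) N → 0ℚ ℚ.≤ seq (max xs f) N
max-nonneg []       f N = ℚₚ.≤-refl
max-nonneg (x ∷ xs) f N = ℚₚ.≤-trans (max-nonneg xs f N) (ℚₚ.p≤q⊔p (seq (f x) N) (seq (max xs f) N))

min⁺-lower : ∀ {a} {X : Set a} (xs : List⁺ X) (f : X → ℝ) N {x} → x ∈ List⁺.toList xs →
             seq (min⁺ xs f) N ℚ.≤ seq (f x) N
min⁺-lower (x ∷ [])     f N (here refl) = ℚₚ.≤-refl
min⁺-lower (x ∷ y ∷ ys) f N (here refl) = ℚₚ.p⊓q≤p (seq (f x) N) (seq (min⁺ (y ∷ ys) f) N)
min⁺-lower (x ∷ y ∷ ys) f N (there x∈)  =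
  ℚₚ.≤-trans (ℚₚ.p⊓q≤q (seq (f x) N) (seq (min⁺ (y ∷ ys) f) N)) (min⁺-lower (y ∷ ys) f N x∈)

seq-· : ∀ {m n} (A : Matrix ℝ m n) x i N → seq ((A · x) i) N ≡ dot ((A at N) i) (λ j → seq (x j) N)
seq-· A x i N = seq-sum (λ j → A i j * x j) N

seq-fromSign : ∀ s N → seq (fromSign s) N ≡ sgn s
seq-fromSign Sign.+ N = refl
seq-fromSign Sign.- N = refl

-- Any one signing bounds the minimum; `σ` is first replaced by the pointwise equal `τ` that occurs
-- in the list.
disc-upper : ∀ {m n} (A : Matrix ℝ m n) N {B} → 0ℚ ℚ.≤ B → (σ : Vector Sign n) →
             (∀ i → ℚ.∣ dot ((A at N) i) (sgn ∘ σ) ∣ ℚ.≤ B) → seq (disc A) N ℚ.≤ B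
disc-upper {m} {n} A N {B} 0≤B σ σ≤ = ℚₚ.≤-trans
  (min⁺-lower (signings n) (λ x → ‖ A · (λ j → fromSign (x j)) ‖∞) N {τ} (proj₁ (proj₂ (∈signings σ))))
  (max-least (List.allFin m) (λ i → ∣ (A · (λ j → fromSign (τ j))) i ∣) N 0≤B λ {i} _ → τ≤ i)
  where
  τ : Vector Sign n
  τ = proj₁ (∈signings σ)
  row : ∀ i → seq ((A · (λ j → fromSign (τ j))) i) N ≡ dot ((A at N) i) (sgn ∘ σ)
  row i = trans (seq-· A (λ j → fromSign (τ j)) i N) (dot-congʳ ((A at N) i) λ j →
    trans (seq-fromSign (τ j) N) (cong sgn (sym (proj₂ (proj₂ (∈signings σ)) j))))
  τ≤ : ∀ i → ℚ.∣ seq ((A · (λ j → fromSign (τ j))) i) N ∣ ℚ.≤ B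
  τ≤ i = subst (λ p → ℚ.∣ p ∣ ℚ.≤ B) (sym (row i)) (σ≤ i)

-- The entries g are kept abstract in the next two lemmas: with the actual
-- entries, comparing two of these maxima unfolds Cauchy proofs.
max₄-least : ∀ {m n} N (g : ∀ k l → Vector (Fin m) (suc k) → Vector (Fin n) (suc l) → ℝ) {B} → 0ℚ ℚ.≤ B →
  (∀ k l s t → s ∈ selections (suc k) m → t ∈ selections (suc l) n → seq (g k l s t) N ℚ.≤ B) →
  seq (max (upTo m) λ k → max (upTo n) λ l →
       max (selections (suc k) m) λ s → max (selections (suc l) n) (g k l s)) N ℚ.≤ B
max₄-least {m} {n} N g {B} 0≤B g≤ =
  max-least (upTo m) (λ k → max (upTo n) λ l → max (selections (suc k) m) λ s → max (selections (suc l) n) (g k l s)) N {B} 0≤B λ {k} _ →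
  max-least (upTo n) (λ l → max (selections (suc k) m) λ s → max (selections (suc l) n) (g k l s)) N {B} 0≤B λ {l} _ →
  max-least (selections (suc k) m) (λ s → max (selections (suc l) n) (g k l s)) N {B} 0≤B λ {s} s∈ →
  max-least (selections (suc l) n) (g k l s) N {B} 0≤B λ {t} t∈ → g≤ k l s t s∈ t∈

max₃-upper : ∀ {m n} N (g : ∀ k → Vector (Fin m) (suc k) → Vector (Fin n) (suc k) → ℝ) k s t →
  s ∈ selections (suc k) m → t ∈ selections (suc k) n →
  seq (g k s t) N ℚ.≤
  seq (max (upTo (m ℕ.⊓ n)) λ k → max (selections (suc k) m) λ s → max (selections (suc k) n) (g k s)) N
max₃-upper {m} {n} N g k s t s∈ t∈ =
  ℚₚ.≤-trans (max-upper {xs = selections (suc k) n} (g k s) N {t} t∈) $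
  ℚₚ.≤-trans (max-upper {xs = selections (suc k) m} (λ s → max (selections (suc k) n) (g k s)) N {s} s∈) $
  max-upper {xs = upTo (m ℕ.⊓ n)} (λ k → max (selections (suc k) m) λ s → max (selections (suc k) n) (g k s)) N {k}
    (∈-upTo⁺ (ℕₚ.⊓-glb (∈selections⇒≤ s∈) (∈selections⇒≤ t∈)))

herdisc-upper : ∀ {m n} (A : Matrix ℝ m n) N {B} → 0ℚ ℚ.≤ B →
  (∀ k l (s : Vector (Fin m) (suc k)) (t : Vector (Fin n) (suc l)) →
    s ∈ selections (suc k) m → t ∈ selections (suc l) n → seq (disc (submatrix A s t)) N ℚ.≤ B) →
  seq (herdisc A) N ℚ.≤ B
herdisc-upper A N = max₄-least N λ k l s t → disc (submatrix A s t)

detlb-lower : ∀ {m n} (A : Matrix ℝ m n) N k (s : Vector (Fin m) (suc k)) (t : Vector (Fin n) (suc k)) →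
  s ∈ selections (suc k) m → t ∈ selections (suc k) n →
  seq (root (suc k) ∣ det (submatrix A s t) ∣) N ℚ.≤ seq (detlb A) N
detlb-lower A N = max₃-upper N λ k s t → root (suc k) ∣ det (submatrix A s t) ∣

-- Approximate roots and vanishing errors

^-mono : ∀ {p q} k → 0ℚ ℚ.≤ p → p ℚ.≤ q → p ^ℚ k ℚ.≤ q ^ℚ k
^-mono zero    0≤p p≤q = ℚₚ.≤-refl
^-mono (suc k) 0≤p p≤q = *-mono 0≤p (0≤^ k (ℚₚ.≤-trans 0≤p p≤q)) p≤q (^-mono k 0≤p p≤q)
  where
  0≤^ : ∀ {p} k → 0ℚ ℚ.≤ p → 0ℚ ℚ.≤ p ^ℚ k
  0≤^ zero    0≤p = ℚₚ.<⇒≤ (ℚₚ.positive⁻¹ 1ℚ)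
  0≤^ (suc k) 0≤p = 0≤*0≤ 0≤p (0≤^ k 0≤p)

-- The mesh of the grid from which `rootApprox` takes its values at index `n`.
1/suc : ℕ → ℚ
1/suc n = + 1 ℚ./ suc n

0<1/suc : ∀ n → 0ℚ ℚ.< 1/suc n
0<1/suc n = ℚₚ.positive⁻¹ (1/suc n) {{ℚₚ.normalize-pos 1 (suc n)}}

archimedean : ∀ ε → 0ℚ ℚ.< ε → ∃[ N ] ∀ n → N ℕ.≤ n → 1/suc n ℚ.< ε
-- The numerator is at least 1, so ε ≥ 1/(d + 1), and n > d makes 1/(n + 1) smaller.
archimedean (mkℚ (+ suc e) d c) _ = suc d , λ n d<n → ℚₚ.toℚᵘ-cancel-< $
  ℚᵘₚ.<-respˡ-≃ (ℚᵘₚ.≃-sym (ℚₚ.toℚᵘ-fromℚᵘ (ℚᵘ.mkℚᵘ (+ 1) n))) $ ℚᵘ.*<* $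
  subst₂ ℤ._<_ (sym (ℤₚ.*-identityˡ (+ suc d))) (ℤₚ.pos-* (suc e) (suc n)) $
  ℤ.+<+ (ℕₚ.<-≤-trans (s≤s d<n) (ℕₚ.m≤n*m (suc n) (suc e)))
archimedean (mkℚ (+ zero)   d c) (ℚ.*<* (ℤ.+<+ ()))
archimedean (mkℚ ℤ.-[1+ e ] d c) (ℚ.*<* ())

p-q<ε : ∀ {p q ε} → p ℚ.< ε → 0ℚ ℚ.≤ q → p ℚ.- q ℚ.< ε
p-q<ε {p} {q} p<ε 0≤q = ℚₚ.≤-<-trans
  (subst (p ℚ.- q ℚ.≤_) (ℚₚ.+-identityʳ p) (ℚₚ.+-monoʳ-≤ p (ℚₚ.neg-antimono-≤ 0≤q))) p<ε

∣p-q∣<ε : ∀ {p q ε} → 0ℚ ℚ.≤ p → 0ℚ ℚ.≤ q → p ℚ.< ε → q ℚ.< ε → ℚ.∣ p ℚ.- q ∣ ℚ.< ε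
∣p-q∣<ε {p} {q} {ε} 0≤p 0≤q p<ε q<ε with ℚₚ.∣p∣≡p∨∣p∣≡-p (p ℚ.- q)
... | inj₁ eq = subst (ℚ._< ε) (sym eq) (p-q<ε p<ε 0≤q)
... | inj₂ eq = subst (ℚ._< ε) (sym (trans eq (lemma p q))) (p-q<ε q<ε 0≤p)
  where
  lemma : ∀ p q → ℚ.- (p ℚ.- q) ≡ q ℚ.- p
  lemma = solve-∀ ℚ-ring

1/sucℝ : ℝ
1/sucℝ = mkℝ 1/suc λ ε 0<ε →
  let N , small = archimedean ε 0<ε
  in N , λ m n N≤m N≤n → ∣p-q∣<ε (ℚₚ.<⇒≤ (0<1/suc m)) (ℚₚ.<⇒≤ (0<1/suc n)) (small m N≤m) (small n N≤n)

x+1/suc≃x : ∀ x → x + 1/sucℝ ≃ x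
x+1/suc≃x x ε 0<ε =
  let N , small = archimedean ε 0<ε
  in N , λ n N≤n → subst (λ p → ℚ.∣ p ∣ ℚ.< ε) (lemma (seq x n) (1/suc n))
       (subst (ℚ._< ε) (sym (ℚₚ.0≤p⇒∣p∣≡p (ℚₚ.<⇒≤ (0<1/suc n)))) (small n N≤n))
  where
  lemma : ∀ p d → d ≡ p ℚ.+ d ℚ.- p
  lemma = solve-∀ ℚ-ring

p≤∣p∣ : ∀ p → p ℚ.≤ ℚ.∣ p ∣
p≤∣p∣ p with ℚₚ.≤-total 0ℚ p
... | inj₁ 0≤p = ℚₚ.≤-reflexive (sym (ℚₚ.0≤p⇒∣p∣≡p 0≤p))
... | inj₂ p≤0 = ℚₚ.≤-trans p≤0 (ℚₚ.0≤∣p∣ p)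

-- Adding the null sequence 1/(N + 1) preserves a real up to `≃`, and products respect `≃`, so the
-- termwise errors are absorbed by the ε that `≤` allows.
≤-up-to-1/suc : ∀ z c x y →
  (∀ N → seq z N ℚ.≤ c ℚ.* ((seq x N ℚ.+ 1/suc N) ℚ.* (seq y N ℚ.+ 1/suc N))) → z ≤ fromℚ c * x * y
≤-up-to-1/suc z c x y z≤ ε 0<ε =
  let N , close = *-cong {fromℚ c * (x + 1/sucℝ)} {fromℚ c * x} {y + 1/sucℝ} {y}
                    (*-cong {fromℚ c} {fromℚ c} {x + 1/sucℝ} {x} c≃c (x+1/suc≃x x)) (x+1/suc≃x y) ε 0<ε
  in N , λ n N≤n → ℚₚ.≤-trans
    (subst (seq z n ℚ.≤_) (sym (ℚₚ.*-assoc c (seq x n ℚ.+ 1/suc n) (seq y n ℚ.+ 1/suc n))) (z≤ n))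
    (p≤q+ε (ℚₚ.<⇒≤ (close n N≤n)))
  where
  c≃c : fromℚ c ≃ fromℚ c
  c≃c ε 0<ε = 0 , λ _ _ → subst (λ p → ℚ.∣ p ∣ ℚ.< ε) (sym (ℚₚ.+-inverseʳ c)) 0<ε
  shift : ∀ p q → q ℚ.+ (p ℚ.- q) ≡ p
  shift = solve-∀ ℚ-ring
  p≤q+ε : ∀ {p q} → ℚ.∣ p ℚ.- q ∣ ℚ.≤ ε → p ℚ.≤ q ℚ.+ ε
  p≤q+ε {p} {q} ≤ε = subst (ℚ._≤ q ℚ.+ ε) (shift p q) (ℚₚ.+-monoʳ-≤ q (ℚₚ.≤-trans (p≤∣p∣ (p ℚ.- q)) ≤ε))

-- `rootApprox` falls short of the true root by less than one mesh width, which is added before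
-- taking the power.
root-upper : ∀ k x N {d} → seq (root (suc k) x) N ℚ.≤ d → ℚ.∣ seq x N ∣ ℚ.≤ (d ℚ.+ 1/suc N) ^ℚ suc k
root-upper k x N root≤d = ℚₚ.≤-trans
  (ℚₚ.<⇒≤ (rootApprox-upper (suc k) N ℚ.∣ seq x N ∣ (ℚₚ.0≤∣p∣ (seq x N))))
  (^-mono (suc k) (ℚₚ.+-mono-≤ (rootApprox-nonNeg (suc k) N ℚ.∣ seq x N ∣) (ℚₚ.<⇒≤ (0<1/suc N)))
    (ℚₚ.+-monoˡ-≤ (1/suc N) root≤d))

-- At index N `detlb` dominates only approximate roots; the added mesh turns it into a bound on the
-- minors themselves.
minors-bounded : ∀ {m n} (A : Matrix ℝ m n) N → MinorsBounded (A at N) (seq (detlb A) N ℚ.+ 1/suc N)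
minors-bounded A N {zero}  s t s↑ t↑ = ℚₚ.≤-refl
minors-bounded A N {suc k} s t s↑ t↑ =
  let s′ , s′∈ , s≡ = increasing⇒∈selections s s↑
      t′ , t′∈ , t≡ = increasing⇒∈selections t t↑
      B = submatrix A s′ t′
      q≤ = root-upper k ∣ det B ∣ N (detlb-lower A N k s′ t′ s′∈ t′∈)
      q≡ = trans (seq-det B N) (det-cong λ i j → sym (cong₂ (A at N) (s≡ i) (t≡ j)))
  in subst (ℚ._≤ (seq (detlb A) N ℚ.+ 1/suc N) ^ℚ suc k)
       (trans (ℚₚ.∣∣p∣∣≡∣p∣ (seq (det B) N)) (cong ℚ.∣_∣ q≡)) q≤

-- The bound at each index, and the limit

·1≡/1 : ∀ n → n ·1 ≡ + n ℚ./ 1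
·1≡/1 zero    = refl
·1≡/1 (suc n) = trans (cong (1ℚ ℚ.+_) (·1≡/1 n)) $ ℚₚ.toℚᵘ-injective $ begin
  ℚ.toℚᵘ (1ℚ ℚ.+ + n ℚ./ 1)             ≈⟨ ℚₚ.toℚᵘ-homo-+ 1ℚ (+ n ℚ./ 1) ⟩
  ℚᵘ.1ℚᵘ ℚᵘ.+ ℚ.toℚᵘ (+ n ℚ./ 1)        ≈⟨ ℚᵘₚ.+-congʳ ℚᵘ.1ℚᵘ (ℚₚ.toℚᵘ-fromℚᵘ (ℚᵘ.mkℚᵘ (+ n) 0)) ⟩
  ℚᵘ.1ℚᵘ ℚᵘ.+ ℚᵘ.mkℚᵘ (+ n) 0           ≈⟨ ℚᵘ.*≡* (lemma (+ n)) ⟩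
  ℚᵘ.mkℚᵘ (+ suc n) 0                   ≈⟨ ℚₚ.toℚᵘ-fromℚᵘ (ℚᵘ.mkℚᵘ (+ suc n) 0) ⟨
  ℚ.toℚᵘ (+ suc n ℚ./ 1)                ∎
  where
  open ℚᵘₚ.≃-Reasoning
  lemma : ∀ i → (+ 1 ℤ.* + 1 ℤ.+ i ℤ.* + 1) ℤ.* + 1 ≡ (+ 1 ℤ.+ i) ℤ.* + 1
  lemma = ℤ-solve-∀

√-upper : ∀ x N → ℚ.∣ seq x N ∣ ℚ.≤ (seq (√ x) N ℚ.+ 1/suc N) ℚ.* (seq (√ x) N ℚ.+ 1/suc N)
√-upper x N = subst (ℚ.∣ seq x N ∣ ℚ.≤_) (square (seq (√ x) N ℚ.+ 1/suc N))
  (root-upper 1 x N {seq (√ x) N} ℚₚ.≤-refl)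
  where
  square : ∀ r → r ^ℚ 2 ≡ r ℚ.* r
  square r = cong (r ℚ.*_) (ℚₚ.*-identityʳ r)

0≤√+1/suc : ∀ x N → 0ℚ ℚ.≤ seq (√ x) N ℚ.+ 1/suc N
0≤√+1/suc x N = ℚₚ.+-mono-≤ (rootApprox-nonNeg 2 N ℚ.∣ seq x N ∣) (ℚₚ.<⇒≤ (0<1/suc N))

0<p+1/suc : ∀ p N → 0ℚ ℚ.≤ p → 0ℚ ℚ.< p ℚ.+ 1/suc N
0<p+1/suc p N 0≤p = ℚₚ.+-mono-≤-< 0≤p (0<1/suc N)

-- A submatrix has at most n columns and inherits the minor bound, so one `r` and one `D` serve them
-- all. Its discrepancy is bounded by rounding the centre of the cube.
herdisc-from-minors : ∀ {m n} (A : Matrix ℝ m n) N r D → 0ℚ ℚ.< D → 0ℚ ℚ.≤ r → n ·1 ℚ.≤ r ℚ.* r →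
                      MinorsBounded (A at N) D → seq (herdisc A) N ℚ.≤ 16ℚ ℚ.* (r ℚ.* D)
herdisc-from-minors {m} {n} A N r D 0<D 0≤r n≤r² bounded = herdisc-upper A N 0≤B λ k l s t s∈ t∈ →
  let Aₛₜ = submatrix (A at N) s t
      σ , σ≤ = low-discrepancy-rounding Aₛₜ 0<D 0≤r
                 (ℚₚ.≤-trans (·1-mono (∈selections⇒≤ t∈)) n≤r²)
                 (λ s′ t′ s′↑ t′↑ → bounded (s ∘ s′) (t ∘ t′)
                   (∈selections⇒increasing s∈ ∘ s′↑) (∈selections⇒increasing t∈ ∘ t′↑))
                 (λ _ → 0ℚ) (λ _ → bounded₁)
  in disc-upper (submatrix A s t) N 0≤B σ λ i →
       subst (λ p → ℚ.∣ p ∣ ℚ.≤ 16ℚ ℚ.* (r ℚ.* D)) (x-0 (dot (Aₛₜ i) (sgn ∘ σ)) (Aₛₜ i)) (σ≤ i)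
  where
  0≤B : 0ℚ ℚ.≤ 16ℚ ℚ.* (r ℚ.* D)
  0≤B = 0≤*0≤ (ℚₚ.<⇒≤ (ℚₚ.positive⁻¹ 16ℚ)) (0≤*0≤ 0≤r (ℚₚ.<⇒≤ 0<D))
  bounded₁ : Bounded₁ 0ℚ
  bounded₁ = toWitness {a? = ℚ.- 1ℚ ℚₚ.≤? 0ℚ} _ , toWitness {a? = 0ℚ ℚₚ.≤? 1ℚ} _
  x-0 : ∀ {l} p (a : Vector ℚ l) → p ℚ.- dot a (λ _ → 0ℚ) ≡ p
  x-0 p a = trans (cong (λ q → p ℚ.- q) (trans (dot-comm a (λ _ → 0ℚ)) (dot-zero (λ _ → refl) a))) (ℚₚ.+-identityʳ p)

herdisc-bound : ∀ {m n} (A : Matrix ℝ m n) N → seq (herdisc A) N ℚ.≤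
  16ℚ ℚ.* ((seq (√ (fromℕ n)) N ℚ.+ 1/suc N) ℚ.* (seq (detlb A) N ℚ.+ 1/suc N))
herdisc-bound {m} {n} A N = herdisc-from-minors A N
  (seq (√ (fromℕ n)) N ℚ.+ 1/suc N) (seq (detlb A) N ℚ.+ 1/suc N)
  -- The mesh keeps D positive even where `detlb` is 0 at this index; the greedy selection needs a
  -- positive threshold.
  (0<p+1/suc (seq (detlb A) N) N (max-nonneg (upTo (m ℕ.⊓ n)) (λ k →
    max (selections (suc k) m) λ s → max (selections (suc k) n) λ t → root (suc k) ∣ det (submatrix A s t) ∣) N))
  (0≤√+1/suc (fromℕ n) N)
  (ℚₚ.≤-trans (ℚₚ.≤-reflexive (·1≡/1 n)) (ℚₚ.≤-trans (p≤∣p∣ (+ n ℚ./ 1)) (√-upper (fromℕ n) N)))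
  (minors-bounded A N)

theorem2 : ∃[ C ] (0ℝ < C) ×
    (∀ (m n : ℕ) .{{_ : NonZero m}} .{{_ : NonZero n}} (A : Matrix ℝ m n) →
    herdisc A ≤ C * √ (fromℕ n) * detlb A)
theorem2 = fromℚ 16ℚ
  , (16ℚ , ℚₚ.positive⁻¹ 16ℚ , 0 , λ _ _ → ℚₚ.≤-refl)
  , λ m n A → ≤-up-to-1/suc (herdisc A) 16ℚ (√ (fromℕ n)) (detlb A) (herdisc-bound A)
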